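{- Let $B$ be a commutative Bézout domain and let $M_V$ be a model of $T_{B,V,div}$, i.e. a $B$-module $M$ expanded by the predicates $V_\delta(M)=Ma$ for $\delta=v(a)\in\Gamma(B)^+$, $a\in B\setminus\{0\}$. Let $\phi(\mathbf y)$ be a positive primitive (pp) $\mathcal L_{B,V}$-formula. Then there are a finite set $K$, a finite covering of $MSpec(B)$ by constructible subsets $C_{\phi,k}$ ($k\in K$), and for each $k\in K$ a conjunction $\psi_k(\mathbf y)$ of atomic $\mathcal L_{B_{\mathcal M},V}$-formulas (for $\mathcal M\in C_{\phi,k}$) such that for every tuple $\mathbf u$ of elements of $M$, $$M_V\models\phi(\mathbf u)\iff \bigwedge_{k\in K}\Big(\text{for all }\mathcal M\in C_{\phi,k},\ (M_{\mathcal M})_V\models\psi_k(\mathbf u_{\mathcal M})\Big),$$ where $\mathbf u_{\mathcal M}$ denotes the image of the tuple $\mathbf u$ in the localization $M_{\mathcal M}$.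
   Context: Rings are commutative integral domains with $1$; $B$ is Bézout if every finitely generated ideal is principal. $Q(B)$ is the fraction field, $U$ the group of units of $B$, and $\Gamma(B)=Q(B)^\times/U$ the group of divisibility, (lattice-)ordered by $aU\le bU$ iff $ba^{ -1}\in B$; its positive part is $\Gamma(B)^+=\{aU: a\in B\setminus\{0\}\}$, and $v(a)=aU$. $MSpec(B)$ is the set of maximal ideals of $B$; its basic closed sets are $V(a)=\{\mathcal M\in MSpec(B): a\in\mathcal M\}$, $a\in B$, and the constructible subsets are the elements of the Boolean algebra generated by the sets $V(a)$. For $\mathcal M\in MSpec(B)$, $B_{\mathcal M}$ is the localization (a valuation domain), $\Gamma(B_{\mathcal M})$ is its value group, $v_{\mathcal M}$ its valuation, and $\delta_{\mathcal M}$ is the image in $\Gamma(B_{\mathcal M})$ of $\delta\in\Gamma(B)$. $M_{\mathcal M}=M\otimes_B B_{\mathcal M}$ is the localization of $M$. For a Bézout domain $R$, $\mathcal L_R=\{+,-,0,\cdot a: a\in R\}$ is the language of $R$-modules and $\mathcal L_{R,V}=\mathcal L_R\cup\{V_\delta:\delta\in\Gamma(R)^+\}$ with unary predicates $V_\delta$. The theory $T_{R,V,div}$ consists of the theory of $R$-modules together with: (1) $V_\delta(0)$; (2) $V_{\delta_1}(m_1)\wedge V_{\delta_2}(m_2)\to V_{\delta_1\wedge\delta_2}(m_1+m_2)$; (3) $V_\delta(m)\to V_{\delta\wedge\mu}(m)$; (4) $V_\delta(m)\to V_{\delta\cdot v(a)}(ma)$ for $a\in R\setminus\{0\}$; (5)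 $\forall m\,V_1(m)$; (6) $V_{v(a)}(m)\to\exists n\,(na=m)$ for $a\in R\setminus\{0\}$ (for all $\delta,\delta_i,\mu\in\Gamma(R)^+$). Equivalently, a model is an $R$-module $N$ with $V_{v(a)}(N)=Na$ for every $a\in R\setminus\{0\}$. In $(M_{\mathcal M})_V$ the predicates are interpreted in this way for the $B_{\mathcal M}$-module $M_{\mathcal M}$: $V_\delta(M_{\mathcal M})=M_{\mathcal M}a$ whenever $\delta=v_{\mathcal M}(a)$. A pp formula is one of the form $\exists\mathbf x\,\theta(\mathbf x,\mathbf y)$ with $\theta$ a conjunction of atomic formulas. That $\psi_k$ is a single conjunction of atomic $\mathcal L_{B_{\mathcal M},V}$-formulas over $C_{\phi,k}$ means: its scalars are elements of $Q(B)$ that lie in $B_{\mathcal M}$ for every $\mathcal M\in C_{\phi,k}$, and its predicates are $V_\delta$ with $\delta\in\Gamma(B)$ such that $\delta_{\mathcal M}\in\Gamma(B_{\mathcal M})^+$ for every $\mathcal M\in C_{\phi,k}$, $V_\delta$ being read as $V_{\delta_{\mathcal M}}$ in $B_{\mathcal M}$-modules. -}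

module Defs where

open import Algebra.Bundles using (AbelianGroup; CommutativeRing)
open import Algebra.Core using (Op₁; Op₂)
open import Algebra.Module.Bundles using (Module)
open import Algebra.Module.Structures using (IsModule)
open import Algebra.Module.Structures.Biased using (IsModuleFromRight)
import Algebra.Properties.CommutativeMonoid.Sum as Sum
import Algebra.Properties.CommutativeSemigroup as CommutativeSemigroupProperties
import Algebra.Properties.Ring as RingProperties
import Algebra.Solver.Ring.NaturalCoefficients.Default as Solver
open import Algebra.Structures using (IsCommutativeRing)
import Algebra.Properties.AbelianGroup as AbelianGroupProperties
import Algebra.Properties.Group as GroupProperties
open import Data.Empty using (⊥-elim)
open import Data.Fin.Base using (Fin)
open import Data.List.Base using (List; map)
open import Data.List.Relation.Unary.All using (All)
open import Data.Nat.Base using (ℕ)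
open import Data.Product.Base using (Σ; ∃; _×_; _,_; proj₁; proj₂)
open import Data.Sum.Base using (_⊎_; inj₁; inj₂; [_,_]; [_,_]′)
open import Function.Base using (_∘_)
open import Function.Bundles using (_⇔_)
open import Level using (_⊔_; suc; Lift)
open import Relation.Binary.Bundles using (Poset)
open import Relation.Binary.Core using (Rel)
import Relation.Binary.Reasoning.Setoid as SetoidReasoning
open import Relation.Nullary.Negation.Core using (¬_)
open import Relation.Unary using (Pred; _∈_; _∉_; _⊆_; _∪_; _∩_; ∁)

-- Zorn's lemma for a poset up to its setoid equality.  Together with excluded
-- middle it is the classical background in which maximal ideals exist.
IsChain : ∀ {a ℓ₁ ℓ₂ p} (P : Poset a ℓ₁ ℓ₂) → Pred (Poset.Carrier P) p → Set (a ⊔ ℓ₂ ⊔ p)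
IsChain P C = ∀ {x y} → x ∈ C → y ∈ C → x ≤ y ⊎ y ≤ x
  where open Poset P

Zorn : ∀ a ℓ₁ ℓ₂ p → Set (suc (a ⊔ ℓ₁ ⊔ ℓ₂ ⊔ p))
Zorn a ℓ₁ ℓ₂ p =
  (P : Poset a ℓ₁ ℓ₂) → let open Poset P in
  ((C : Pred Carrier p) → IsChain P C → ∃ λ b → ∀ {x} → x ∈ C → x ≤ b) →
  ∃ λ m → ∀ {x} → m ≤ x → m ≈ x

record IntegralDomain c ℓ : Set (suc (c ⊔ ℓ)) where
  field
    commutativeRing : CommutativeRing c ℓ

  open CommutativeRing commutativeRing public

  field
    1≉0         : ¬ 1# ≈ 0#
    zeroProduct : ∀ {x y} → x * y ≈ 0# → x ≈ 0# ⊎ y ≈ 0#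

  *-≉0 : ∀ {x y} → ¬ x ≈ 0# → ¬ y ≈ 0# → ¬ x * y ≈ 0#
  *-≉0 x≉0 y≉0 xy≈0 = [ x≉0 , y≉0 ] (zeroProduct xy≈0)

  *-cancelʳ : ∀ {x y z} → ¬ z ≈ 0# → x * z ≈ y * z → x ≈ y
  *-cancelʳ {x} {y} {z} z≉0 xz≈yz =
    [ x∙y⁻¹≈ε⇒x≈y x y , ⊥-elim ∘ z≉0 ]′ (zeroProduct
      (trans ([y-z]x≈yx-zx z x y) (x≈y⇒x∙y⁻¹≈ε xz≈yz)))
    where
    open RingProperties ring using ([y-z]x≈yx-zx)
    open GroupProperties +-group using (x≈y⇒x∙y⁻¹≈ε; x∙y⁻¹≈ε⇒x≈y)

  IsUnit : Pred Carrier (c ⊔ ℓ)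
  IsUnit u = ∃ λ w → u * w ≈ 1#

  NonZero : Set (c ⊔ ℓ)
  NonZero = Σ Carrier λ a → ¬ a ≈ 0#

  Span : ∀ {n} → (Fin n → Carrier) → Pred Carrier (c ⊔ ℓ)
  Span {n} g x = Σ (Fin n → Carrier) λ r → x ≈ Sum.sum +-commutativeMonoid (λ i → r i * g i)

  IsBezout : Set (c ⊔ ℓ)
  IsBezout = ∀ {n} (g : Fin n → Carrier) →
             ∃ λ d → ∀ x → x ∈ Span g ⇔ x ∈ Span {1} (λ _ → d)

record BezoutDomain c ℓ : Set (suc (c ⊔ ℓ)) where
  field
    integralDomain : IntegralDomain c ℓ

  open IntegralDomain integralDomain public

  field
    isBezout : IsBezout

module FractionField {c ℓ} (D : IntegralDomain c ℓ) where
  open IntegralDomain D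

  infix 5 _/_∶_

  record Q : Set (c ⊔ ℓ) where
    constructor _/_∶_
    field
      num   : Carrier
      den   : Carrier
      den≉0 : ¬ den ≈ 0#

  open Q public

  infix 4 _≈Q_
  infixl 6 _+Q_
  infixl 7 _*Q_

  record _≈Q_ (p q : Q) : Set ℓ where
    constructor cross
    field
      uncross : num p * den q ≈ num q * den p

  open _≈Q_ public

  _+Q_ _*Q_ : Op₂ Q
  (a / b ∶ b≉0) +Q (c / d ∶ d≉0) = (a * d + c * b) / (b * d) ∶ *-≉0 b≉0 d≉0
  (a / b ∶ b≉0) *Q (c / d ∶ d≉0) = (a * c) / (b * d) ∶ *-≉0 b≉0 d≉0

  -Q_ : Op₁ Q
  -Q (a / b ∶ b≉0) = (- a) / b ∶ b≉0

  ι : Carrier → Q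
  ι a = a / 1# ∶ 1≉0

  private
    open Solver commutativeSemiring using (solve; _:=_; _:+_; _:*_)

    ≈Q-trans : ∀ {p q r} → p ≈Q q → q ≈Q r → p ≈Q r
    ≈Q-trans {a / b ∶ _} {c / d ∶ d≉0} {e / f ∶ _} (cross ad≈cb) (cross cf≈ed) = cross (*-cancelʳ d≉0
      (trans (solve 3 (λ a f d → (a :* f) :* d := (a :* d) :* f) refl a f d)
      (trans (*-congʳ ad≈cb)
      (trans (solve 3 (λ c b f → (c :* b) :* f := (c :* f) :* b) refl c b f)
      (trans (*-congʳ cf≈ed)
             (solve 3 (λ e d b → (e :* d) :* b := (e :* b) :* d) refl e d b))))))

    +Q-cong : ∀ {p p′ q q′} → p ≈Q p′ → q ≈Q q′ → p +Q q ≈Q p′ +Q q′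
    +Q-cong {a / b ∶ _} {a′ / b′ ∶ _} {c / d ∶ _} {c′ / d′ ∶ _} (cross p≈p′) (cross q≈q′) = cross
      (trans (solve 6 (λ a b c d b′ d′ → (a :* d :+ c :* b) :* (b′ :* d′) :=
                         (a :* b′) :* (d :* d′) :+ (c :* d′) :* (b :* b′)) refl a b c d b′ d′)
      (trans (+-cong (*-congʳ p≈p′) (*-congʳ q≈q′))
             (solve 6 (λ a′ b c′ d b′ d′ → (a′ :* b) :* (d :* d′) :+ (c′ :* d) :* (b :* b′) :=
                         (a′ :* d′ :+ c′ :* b′) :* (b :* d)) refl a′ b c′ d b′ d′)))

    *Q-cong : ∀ {p p′ q q′} → p ≈Q p′ → q ≈Q q′ → p *Q q ≈Q p′ *Q q′
    *Q-cong {a / b ∶ _} {a′ / b′ ∶ _} {c / d ∶ _} {c′ / d′ ∶ _} (cross p≈p′) (cross q≈q′) = cross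
      (trans (interchange a c b′ d′)
      (trans (*-cong p≈p′ q≈q′) (interchange a′ b c′ d)))
      where open CommutativeSemigroupProperties *-commutativeSemigroup using (interchange)

    -Q-cong : ∀ {p q} → p ≈Q q → -Q p ≈Q -Q q
    -Q-cong {a / b ∶ _} {c / d ∶ _} (cross ad≈cb) = cross
      (trans (sym (-‿distribˡ-* a d)) (trans (-‿cong ad≈cb) (-‿distribˡ-* c b)))
      where open RingProperties ring using (-‿distribˡ-*)

    +Q-assoc : ∀ p q r → (p +Q q) +Q r ≈Q p +Q (q +Q r)
    +Q-assoc (a / b ∶ _) (c / d ∶ _) (e / f ∶ _) = cross
      (solve 6 (λ a b c d e f →
        ((a :* d :+ c :* b) :* f :+ e :* (b :* d)) :* (b :* (d :* f)) :=
        (a :* (d :* f) :+ (c :* f :+ e :* d) :* b) :* ((b :* d) :* f)) refl a b c d e f)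

    +Q-comm : ∀ p q → p +Q q ≈Q q +Q p
    +Q-comm (a / b ∶ _) (c / d ∶ _) = cross
      (solve 4 (λ a b c d → (a :* d :+ c :* b) :* (d :* b) :=
                            (c :* b :+ a :* d) :* (b :* d)) refl a b c d)

    *Q-assoc : ∀ p q r → (p *Q q) *Q r ≈Q p *Q (q *Q r)
    *Q-assoc (a / b ∶ _) (c / d ∶ _) (e / f ∶ _) = cross
      (*-cong (*-assoc a c e) (sym (*-assoc b d f)))

    *Q-comm : ∀ p q → p *Q q ≈Q q *Q p
    *Q-comm (a / b ∶ _) (c / d ∶ _) = cross (*-cong (*-comm a c) (*-comm d b))

    +Q-identityˡ : ∀ p → ι 0# +Q p ≈Q p
    +Q-identityˡ (a / b ∶ _) = cross (*-cong
      (trans (+-cong (zeroˡ b) (*-identityʳ a)) (+-identityˡ a)) (sym (*-identityˡ b)))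

    *Q-identityˡ : ∀ p → ι 1# *Q p ≈Q p
    *Q-identityˡ (a / b ∶ _) = cross (*-cong (*-identityˡ a) (sym (*-identityˡ b)))

    *Q-distribˡ : ∀ p q r → p *Q (q +Q r) ≈Q p *Q q +Q p *Q r
    *Q-distribˡ (a / b ∶ _) (c / d ∶ _) (e / f ∶ _) = cross
      (solve 6 (λ a b c d e f →
        (a :* (c :* f :+ e :* d)) :* ((b :* d) :* (b :* f)) :=
        ((a :* c) :* (b :* f) :+ (a :* e) :* (b :* d)) :* (b :* (d :* f))) refl a b c d e f)

  ≈0 : ∀ {p} → num p ≈ 0# → p ≈Q ι 0#
  ≈0 a≈0 = cross (trans (*-identityʳ _) (trans a≈0 (sym (zeroˡ _))))

  num≈0 : ∀ {p} → p ≈Q ι 0# → num p ≈ 0#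
  num≈0 {p} (cross p≈0) = trans (sym (*-identityʳ (num p))) (trans p≈0 (zeroˡ (den p)))

  private
    -Q-inverseˡ : ∀ p → (-Q p) +Q p ≈Q ι 0#
    -Q-inverseˡ (a / b ∶ _) = ≈0 (trans (sym (distribʳ b (- a) a))
      (trans (*-congʳ (-‿inverseˡ a)) (zeroˡ b)))

  abstract
    Q-isCommutativeRing : IsCommutativeRing _≈Q_ _+Q_ _*Q_ -Q_ (ι 0#) (ι 1#)
    Q-isCommutativeRing = record
      { isRing = record
        { +-isAbelianGroup = record
          { isGroup = record
            { isMonoid = record
              { isSemigroup = record
                { isMagma = record
                  { isEquivalence = record
                    { refl  = cross refl
                    ; sym   = λ (cross e) → cross (sym e)
                    ; trans = ≈Q-trans
                    }
                  ; ∙-cong = +Q-cong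
                  }
                ; assoc = +Q-assoc
                }
              ; identity = +Q-identityˡ , λ p → ≈Q-trans (+Q-comm p (ι 0#)) (+Q-identityˡ p)
              }
            ; inverse = -Q-inverseˡ , λ p → ≈Q-trans (+Q-comm p (-Q p)) (-Q-inverseˡ p)
            ; ⁻¹-cong = -Q-cong
            }
          ; comm = +Q-comm
          }
        ; *-cong = *Q-cong
        ; *-assoc = *Q-assoc
        ; *-identity = *Q-identityˡ , λ p → ≈Q-trans (*Q-comm p (ι 1#)) (*Q-identityˡ p)
        ; distrib = *Q-distribˡ , λ p q r → ≈Q-trans (*Q-comm (q +Q r) p) (≈Q-trans (*Q-distribˡ p q r)
            (+Q-cong (*Q-comm p q) (*Q-comm p r)))
        }
      ; *-comm = *Q-comm
      }

  fractionField : IntegralDomain (c ⊔ ℓ) ℓ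
  fractionField = record
    { commutativeRing = record
      { Carrier = Q
      ; _≈_ = _≈Q_
      ; _+_ = _+Q_
      ; _*_ = _*Q_
      ; -_  = -Q_
      ; 0#  = ι 0#
      ; 1#  = ι 1#
      ; isCommutativeRing = Q-isCommutativeRing
      }
    ; 1≉0 = 1≉0 ∘ num≈0
    ; zeroProduct = λ pq≈0 → [ inj₁ ∘ ≈0 , inj₂ ∘ ≈0 ]′ (zeroProduct (num≈0 pq≈0))
    }

module Divisibility {c ℓ} (D : IntegralDomain c ℓ) where
  open IntegralDomain D
  open FractionField D
  private module QD = IntegralDomain fractionField

  infix 4 _≈Γ_ _≤Γ_
  infixl 7 _·Γ_

  -- Elements of Q(D)^×, to be compared modulo units by _≈Γ_.
  Γ : Set (c ⊔ ℓ)
  Γ = QD.NonZero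

  _⁻¹ : Γ → Q
  (q , q≉0) ⁻¹ = den q / num q ∶ q≉0 ∘ ≈0

  _≈Γ_ : Rel Γ (c ⊔ ℓ)
  δ ≈Γ μ = ∃ λ u → IsUnit u × proj₁ δ ≈Q ι u *Q proj₁ μ

  _≤Γ_ : Rel Γ (c ⊔ ℓ)
  δ ≤Γ μ = ∃ λ b → proj₁ μ *Q δ ⁻¹ ≈Q ι b

  _·Γ_ : Op₂ Γ
  (p , p≉0) ·Γ (q , q≉0) = p *Q q , QD.*-≉0 p≉0 q≉0

  v : NonZero → Γ
  v (a , a≉0) = ι a , a≉0 ∘ num≈0

  IsMeet : Γ → Γ → Γ → Set (c ⊔ ℓ)
  IsMeet δ μ ε = ε ≤Γ δ × ε ≤Γ μ × (∀ η → η ≤Γ δ → η ≤Γ μ → η ≤Γ ε)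

  Positive : Pred Γ (c ⊔ ℓ)
  Positive δ = Σ NonZero λ a → δ ≈Γ v a

  Γ⁺ : Set (c ⊔ ℓ)
  Γ⁺ = Σ Γ Positive

  v⁺ : NonZero → Γ⁺
  v⁺ a = v a , a , 1# , (1# , *-identityˡ 1#) ,
    QD.sym (QD.*-identityˡ (ι (proj₁ a)))

  abstract
    ·-positive : ∀ {δ μ} → Positive δ → Positive μ → Positive (δ ·Γ μ)
    ·-positive {δ , _} {μ , _} ((a , a≉0) , u , (u⁻¹ , uu⁻¹≈1) , δ≈ua)
                               ((b , b≉0) , w , (w⁻¹ , ww⁻¹≈1) , μ≈wb) =
      (a * b , *-≉0 a≉0 b≉0) , u * w ,
      (u⁻¹ * w⁻¹ , trans (interchange u w u⁻¹ w⁻¹)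
                         (trans (*-cong uu⁻¹≈1 ww⁻¹≈1) (*-identityˡ 1#))) ,
      (begin
        δ *Q μ                       ≈⟨ QD.*-cong δ≈ua μ≈wb ⟩
        (ι u *Q ι a) *Q (ι w *Q ι b) ≈⟨ Q-interchange (ι u) (ι a) (ι w) (ι b) ⟩
        (ι u *Q ι w) *Q (ι a *Q ι b) ≈⟨ QD.*-cong (ι-* u w) (ι-* a b) ⟩
        ι (u * w) *Q ι (a * b)       ∎)
      where
      open CommutativeSemigroupProperties *-commutativeSemigroup using (interchange)
      open CommutativeSemigroupProperties QD.*-commutativeSemigroup
        using () renaming (interchange to Q-interchange)
      open SetoidReasoning QD.setoid
      ι-* : ∀ x y → ι x *Q ι y ≈Q ι (x * y)
      ι-* x y = cross (*-congˡ (sym (*-identityˡ 1#)))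

  _·⁺_ : Op₂ Γ⁺
  (δ , δ⁺) ·⁺ (μ , μ⁺) = δ ·Γ μ , ·-positive {δ} {μ} δ⁺ μ⁺

infixl 7 _·ᵗ_
infixl 6 _+ᵗ_
infix 4 _≐_

data Term {s x} (S : Set s) (X : Set x) : Set (s ⊔ x) where
  var  : X → Term S X
  0ᵗ   : Term S X
  _+ᵗ_ : Term S X → Term S X → Term S X
  -ᵗ_  : Term S X → Term S X
  _·ᵗ_ : Term S X → S → Term S X

data Atomic {s g x} (S : Set s) (G : Set g) (X : Set x) : Set (s ⊔ g ⊔ x) where
  _≐_ : Term S X → Term S X → Atomic S G X
  V   : G → Term S X → Atomic S G X

Conjunction : ∀ {s g x} → Set s → Set g → Set x → Set (s ⊔ g ⊔ x)
Conjunction S G X = List (Atomic S G X)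

record PPFormula {s g} (S : Set s) (G : Set g) (n : ℕ) : Set (s ⊔ g) where
  constructor ∃[_]_
  field
    bound  : ℕ
    matrix : Conjunction S G (Fin bound ⊎ Fin n)

mapTerm : ∀ {s s′ x} {S : Set s} {S′ : Set s′} {X : Set x} →
          (S → S′) → Term S X → Term S′ X
mapTerm f (var x)  = var x
mapTerm f 0ᵗ       = 0ᵗ
mapTerm f (t +ᵗ u) = mapTerm f t +ᵗ mapTerm f u
mapTerm f (-ᵗ t)   = -ᵗ mapTerm f t
mapTerm f (t ·ᵗ a) = mapTerm f t ·ᵗ f a

mapAtomic : ∀ {s s′ g g′ x} {S : Set s} {S′ : Set s′} {G : Set g} {G′ : Set g′} {X : Set x} →
            (S → S′) → (G → G′) → Atomic S G X → Atomic S′ G′ X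
mapAtomic f h (t ≐ u) = mapTerm f t ≐ mapTerm f u
mapAtomic f h (V δ t) = V (h δ) (mapTerm f t)

-- Modules are read as right modules, with the scalar a of the language acting
-- by _*ᵣ a.
module Semantics {c ℓ} (D : IntegralDomain c ℓ) where
  open IntegralDomain D using (Carrier; commutativeRing; NonZero; 1#; 1≉0)
  open Divisibility D

  module _ {m ℓm} (N : Module commutativeRing m ℓm) where
    open Module N

    eval : ∀ {x} {X : Set x} → (X → Carrierᴹ) → Term Carrier X → Carrierᴹ
    eval ρ (var x)  = ρ x
    eval ρ 0ᵗ       = 0ᴹ
    eval ρ (t +ᵗ u) = eval ρ t +ᴹ eval ρ u
    eval ρ (-ᵗ t)   = -ᴹ eval ρ t
    eval ρ (t ·ᵗ a) = eval ρ t *ᵣ a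

    module _ {p} (⟦V⟧ : Γ⁺ → Pred Carrierᴹ p) where

      ⟦_⟧ₐ : ∀ {x} {X : Set x} → Atomic Carrier Γ⁺ X → (X → Carrierᴹ) → Set (ℓm ⊔ p)
      ⟦ t ≐ u ⟧ₐ ρ = Lift p (eval ρ t ≈ᴹ eval ρ u)
      ⟦ V δ t ⟧ₐ ρ = Lift ℓm (⟦V⟧ δ (eval ρ t))

      ⟦_⟧ᶜ : ∀ {x} {X : Set x} → Conjunction Carrier Γ⁺ X → (X → Carrierᴹ) →
             Set (c ⊔ ℓ ⊔ x ⊔ ℓm ⊔ p)
      ⟦ as ⟧ᶜ ρ = All (λ a → ⟦ a ⟧ₐ ρ) as

      ⟦_⟧ₚₚ : ∀ {n} → PPFormula Carrier Γ⁺ n → (Fin n → Carrierᴹ) →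
              Set (c ⊔ ℓ ⊔ m ⊔ ℓm ⊔ p)
      ⟦ ∃[ b ] as ⟧ₚₚ u = Σ (Fin b → Carrierᴹ) λ w → ⟦ as ⟧ᶜ [ w , u ]′

    -- V_δ(N) = Na whenever δ = v(a).
    canonicalV : Γ⁺ → Pred Carrierᴹ (c ⊔ ℓ ⊔ m ⊔ ℓm)
    canonicalV (δ , _) x = Σ NonZero λ a → δ ≈Γ v a × (∃ λ n → n *ᵣ proj₁ a ≈ᴹ x)

  -- Models of T_{D,V,div}.  The meet of the lattice Γ(D) enters through its
  -- universal property, and V-resp is the congruence that first-order logic
  -- with equality imposes on setoid representatives.
  record TVdivModel m ℓm p : Set (c ⊔ ℓ ⊔ suc (m ⊔ ℓm ⊔ p)) where
    field
      module′ : Module commutativeRing m ℓm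

    open Module module′ public

    field
      ⟦V⟧    : Γ⁺ → Pred Carrierᴹ p
      V-resp : ∀ {δ μ : Γ⁺} {x y} → proj₁ δ ≈Γ proj₁ μ → x ≈ᴹ y → ⟦V⟧ δ x → ⟦V⟧ μ y
      V-0    : ∀ (δ : Γ⁺) → ⟦V⟧ δ 0ᴹ
      V-+    : ∀ {δ μ ε : Γ⁺} {x y} → IsMeet (proj₁ δ) (proj₁ μ) (proj₁ ε) →
               ⟦V⟧ δ x → ⟦V⟧ μ y → ⟦V⟧ ε (x +ᴹ y)
      V-∧    : ∀ {δ μ ε : Γ⁺} {x} → IsMeet (proj₁ δ) (proj₁ μ) (proj₁ ε) →
               ⟦V⟧ δ x → ⟦V⟧ ε x
      V-·    : ∀ {δ : Γ⁺} {x} (a : NonZero) → ⟦V⟧ δ x → ⟦V⟧ (δ ·⁺ v⁺ a) (x *ᵣ proj₁ a)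
      V-1    : ∀ x → ⟦V⟧ (v⁺ (1# , 1≉0)) x
      V-div  : ∀ {x} (a : NonZero) → ⟦V⟧ (v⁺ a) x → ∃ λ n → n *ᵣ proj₁ a ≈ᴹ x

    _⊨_[_] : ∀ {n} → PPFormula Carrier Γ⁺ n → (Fin n → Carrierᴹ) → Set (c ⊔ ℓ ⊔ m ⊔ ℓm ⊔ p)
    _⊨_[_] = ⟦_⟧ₚₚ module′ ⟦V⟧

module Spectrum {c ℓ} (D : IntegralDomain c ℓ) where
  open IntegralDomain D

  record IsIdeal {p} (I : Pred Carrier p) : Set (c ⊔ ℓ ⊔ p) where
    field
      resp     : ∀ {x y} → x ≈ y → x ∈ I → y ∈ I
      0∈       : 0# ∈ I
      +-closed : ∀ {x y} → x ∈ I → y ∈ I → x + y ∈ I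
      *-closed : ∀ r {x} → x ∈ I → r * x ∈ I

  record MSpec : Set (suc (c ⊔ ℓ)) where
    field
      ideal   : Pred Carrier (c ⊔ ℓ)
      isIdeal : IsIdeal ideal
      proper  : 1# ∉ ideal
      maximal : ∀ {J : Pred Carrier (c ⊔ ℓ)} → IsIdeal J → 1# ∉ J →
                ideal ⊆ J → J ⊆ ideal

    open IsIdeal isIdeal public

    ∉⇒≉0 : ∀ {s} → s ∉ ideal → ¬ s ≈ 0#
    ∉⇒≉0 s∉ s≈0 = s∉ (resp (sym s≈0) 0∈)

    *-∉ : ∀ {s t} → s ∉ ideal → t ∉ ideal → s * t ∉ ideal
    *-∉ {s} {t} s∉ t∉ st∈ = s∉ (maximal {J} J-isIdeal 1∉J (*-∈ _) st∈)
      where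
      J : Pred Carrier (c ⊔ ℓ)
      J x = x * t ∈ ideal
      *-∈ : ∀ y {x} → x ∈ ideal → x * y ∈ ideal
      *-∈ y x∈ = resp (*-comm y _) (*-closed y x∈)
      J-isIdeal : IsIdeal J
      J-isIdeal = record
        { resp     = resp ∘ *-congʳ
        ; 0∈       = *-∈ t 0∈
        ; +-closed = λ xt∈ yt∈ → resp (sym (distribʳ t _ _)) (+-closed xt∈ yt∈)
        ; *-closed = λ r xt∈ → resp (sym (*-assoc r _ t)) (*-closed r xt∈)
        }
      1∉J : 1# ∉ J
      1∉J = t∉ ∘ resp (*-identityˡ t)

  -- Expressions for the elements of the Boolean algebra generated by the V(a);
  -- the empty and the full set are V[ 1# ] and V[ 0# ].
  data Constructible : Set c where
    V[_]      : Carrier → Constructible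
    _∪ᶜ_ _∩ᶜ_ : Constructible → Constructible → Constructible
    ∁ᶜ        : Constructible → Constructible

  ⟦_⟧ : Constructible → Pred MSpec (c ⊔ ℓ)
  ⟦ V[ a ] ⟧ 𝓜 = a ∈ MSpec.ideal 𝓜
  ⟦ C ∪ᶜ D ⟧ = ⟦ C ⟧ ∪ ⟦ D ⟧
  ⟦ C ∩ᶜ D ⟧ = ⟦ C ⟧ ∩ ⟦ D ⟧
  ⟦ ∁ᶜ C ⟧   = ∁ ⟦ C ⟧

module Localization {c ℓ} (D : IntegralDomain c ℓ) (𝓜 : Spectrum.MSpec D) where
  open IntegralDomain D
  open FractionField D
  open Spectrum D using (module MSpec)
  open MSpec 𝓜 using (ideal; proper; ∉⇒≉0; *-∉)
  private module QD = IntegralDomain fractionField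

  -- D_𝓜 is realised as a subring of Q(D): the fractions that can be written with
  -- a denominator outside 𝓜.
  record InLocal (q : Q) : Set (c ⊔ ℓ) where
    constructor inLocal
    field
      a s : Carrier
      s∉  : s ∉ ideal
      q≈  : q ≈Q a / s ∶ ∉⇒≉0 s∉

  private
    ι-∈ : ∀ a → InLocal (ι a)
    ι-∈ a = inLocal a 1# proper (cross refl)

    abstract
      +-∈ : ∀ {p q} → InLocal p → InLocal q → InLocal (p +Q q)
      +-∈ (inLocal a s s∉ p≈) (inLocal b t t∉ q≈) =
        inLocal (a * t + b * s) (s * t) (*-∉ s∉ t∉) (QD.trans (QD.+-cong p≈ q≈) (cross refl))

      *-∈ : ∀ {p q} → InLocal p → InLocal q → InLocal (p *Q q)
      *-∈ (inLocal a s s∉ p≈) (inLocal b t t∉ q≈) =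
        inLocal (a * b) (s * t) (*-∉ s∉ t∉) (QD.trans (QD.*-cong p≈ q≈) (cross refl))

      -‿∈ : ∀ {p} → InLocal p → InLocal (-Q p)
      -‿∈ (inLocal a s s∉ p≈) = inLocal (- a) s s∉ (QD.trans (QD.-‿cong p≈) (cross refl))

  Local : Set (c ⊔ ℓ)
  Local = Σ Q InLocal

  record _≈L_ (p q : Local) : Set ℓ where
    constructor inQ
    field
      fromL : proj₁ p ≈Q proj₁ q

  open _≈L_ public

  _+L_ _*L_ : Op₂ Local
  (p , p∈) +L (q , q∈) = p +Q q , +-∈ p∈ q∈
  (p , p∈) *L (q , q∈) = p *Q q , *-∈ p∈ q∈

  -L_ : Op₁ Local
  -L (p , p∈) = -Q p , -‿∈ p∈

  0L 1L : Local
  0L = ι 0# , ι-∈ 0#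
  1L = ι 1# , ι-∈ 1#

  abstract
    L-isCommutativeRing : IsCommutativeRing _≈L_ _+L_ _*L_ -L_ 0L 1L
    L-isCommutativeRing = record
      { isRing = record
        { +-isAbelianGroup = record
          { isGroup = record
            { isMonoid = record
              { isSemigroup = record
                { isMagma = record
                  { isEquivalence = record
                    { refl  = inQ QD.refl
                    ; sym   = λ (inQ e) → inQ (QD.sym e)
                    ; trans = λ (inQ e) (inQ f) → inQ (QD.trans e f)
                    }
                  ; ∙-cong = λ (inQ e) (inQ f) → inQ (QD.+-cong e f)
                  }
                ; assoc = λ (p , _) (q , _) (r , _) → inQ (QD.+-assoc p q r)
                }
              ; identity = (λ (p , _) → inQ (QD.+-identityˡ p))
                         , (λ (p , _) → inQ (QD.+-identityʳ p))
              }
            ; inverse = (λ (p , _) → inQ (QD.-‿inverseˡ p))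
                      , (λ (p , _) → inQ (QD.-‿inverseʳ p))
            ; ⁻¹-cong = λ (inQ e) → inQ (QD.-‿cong e)
            }
          ; comm = λ (p , _) (q , _) → inQ (QD.+-comm p q)
          }
        ; *-cong = λ (inQ e) (inQ f) → inQ (QD.*-cong e f)
        ; *-assoc = λ (p , _) (q , _) (r , _) → inQ (QD.*-assoc p q r)
        ; *-identity = (λ (p , _) → inQ (QD.*-identityˡ p))
                     , (λ (p , _) → inQ (QD.*-identityʳ p))
        ; distrib = (λ (p , _) (q , _) (r , _) → inQ (QD.distribˡ p q r))
                  , (λ (p , _) (q , _) (r , _) → inQ (QD.distribʳ p q r))
        }
      ; *-comm = λ (p , _) (q , _) → inQ (QD.*-comm p q)
      }

  localDomain : IntegralDomain (c ⊔ ℓ) ℓ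
  localDomain = record
    { commutativeRing = record
      { Carrier = Local
      ; _≈_ = _≈L_
      ; _+_ = _+L_
      ; _*_ = _*L_
      ; -_  = -L_
      ; 0#  = 0L
      ; 1#  = 1L
      ; isCommutativeRing = L-isCommutativeRing
      }
    ; 1≉0 = QD.1≉0 ∘ fromL
    ; zeroProduct = λ (inQ pq≈0) → [ inj₁ ∘ inQ , inj₂ ∘ inQ ]′ (QD.zeroProduct pq≈0)
    }

  private module L = IntegralDomain localDomain

  localize : Carrier → L.Carrier
  localize a = ι a , ι-∈ a

  -- The map Γ(D) → Γ(D_𝓜) induced by D → D_𝓜, sending n/d to localize n / localize d.
  localizeΓ : Divisibility.Γ D → Divisibility.Γ localDomain
  localizeΓ (q , q≉0) =
    record { num = localize (num q) ; den = localize (den q)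
           ; den≉0 = den≉0 q ∘ num≈0 ∘ fromL } ,
    q≉0 ∘ ≈0 ∘ num≈0 ∘ fromL ∘ FractionField.num≈0 localDomain

  -- M ⊗_D D_𝓜: the free abelian group on symbols x ⊗ q, modulo biadditivity
  -- and balance.
  module _ {m ℓm} (M : Module commutativeRing m ℓm) where
    open Module M

    infix 8 _⊗_
    infixl 6 _+⊗_
    infix 4 _≈⊗_

    data Tensor : Set (c ⊔ ℓ ⊔ m) where
      _⊗_  : Carrierᴹ → L.Carrier → Tensor
      0⊗   : Tensor
      _+⊗_ : Tensor → Tensor → Tensor
      -⊗_  : Tensor → Tensor

    data _≈⊗_ : Rel Tensor (c ⊔ ℓ ⊔ m ⊔ ℓm) where
      refl⊗  : ∀ {t} → t ≈⊗ t
      sym⊗   : ∀ {t u} → t ≈⊗ u → u ≈⊗ t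
      trans⊗ : ∀ {t u w} → t ≈⊗ u → u ≈⊗ w → t ≈⊗ w
      +-cong⊗ : ∀ {t t′ u u′} → t ≈⊗ t′ → u ≈⊗ u′ → t +⊗ u ≈⊗ t′ +⊗ u′
      -‿cong⊗ : ∀ {t u} → t ≈⊗ u → -⊗ t ≈⊗ -⊗ u
      ⊗-cong  : ∀ {x y p q} → x ≈ᴹ y → p L.≈ q → x ⊗ p ≈⊗ y ⊗ q
      assoc⊗     : ∀ t u w → (t +⊗ u) +⊗ w ≈⊗ t +⊗ (u +⊗ w)
      comm⊗      : ∀ t u → t +⊗ u ≈⊗ u +⊗ t
      identityˡ⊗ : ∀ t → 0⊗ +⊗ t ≈⊗ t
      inverseˡ⊗  : ∀ t → (-⊗ t) +⊗ t ≈⊗ 0⊗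
      distribˡ⊗  : ∀ x p q → x ⊗ (p L.+ q) ≈⊗ x ⊗ p +⊗ x ⊗ q
      distribʳ⊗  : ∀ x y p → (x +ᴹ y) ⊗ p ≈⊗ x ⊗ p +⊗ y ⊗ p
      balanced   : ∀ x b p → (x *ᵣ b) ⊗ p ≈⊗ x ⊗ (localize b L.* p)

    infixl 7 _*⊗_

    _*⊗_ : Tensor → L.Carrier → Tensor
    (x ⊗ p)  *⊗ q = x ⊗ (p L.* q)
    0⊗       *⊗ q = 0⊗
    (t +⊗ u) *⊗ q = t *⊗ q +⊗ u *⊗ q
    (-⊗ t)   *⊗ q = -⊗ (t *⊗ q)

    private
      additive : AbelianGroup _ _
      additive = record
        { _≈_ = _≈⊗_
        ; _∙_ = _+⊗_
        ; ε   = 0⊗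
        ; _⁻¹ = -⊗_
        ; isAbelianGroup = record
          { isGroup = record
            { isMonoid = record
              { isSemigroup = record
                { isMagma = record
                  { isEquivalence = record { refl = refl⊗ ; sym = sym⊗ ; trans = trans⊗ }
                  ; ∙-cong = +-cong⊗
                  }
                ; assoc = assoc⊗
                }
              ; identity = identityˡ⊗ , λ t → trans⊗ (comm⊗ t 0⊗) (identityˡ⊗ t)
              }
            ; inverse = inverseˡ⊗ , λ t → trans⊗ (comm⊗ t (-⊗ t)) (inverseˡ⊗ t)
            ; ⁻¹-cong = -‿cong⊗
            }
          ; comm = comm⊗
          }
        }
      module A = AbelianGroup additive
      open GroupProperties A.group using (ε⁻¹≈ε; identityʳ-unique)
      open AbelianGroupProperties additive using (⁻¹-∙-comm)
      open CommutativeSemigroupProperties A.commutativeSemigroup using (interchange)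

      *⊗-congʳ : ∀ q {t u} → t ≈⊗ u → t *⊗ q ≈⊗ u *⊗ q
      *⊗-congʳ q refl⊗                = refl⊗
      *⊗-congʳ q (sym⊗ e)             = sym⊗ (*⊗-congʳ q e)
      *⊗-congʳ q (trans⊗ e f)         = trans⊗ (*⊗-congʳ q e) (*⊗-congʳ q f)
      *⊗-congʳ q (+-cong⊗ e f)        = +-cong⊗ (*⊗-congʳ q e) (*⊗-congʳ q f)
      *⊗-congʳ q (-‿cong⊗ e)          = -‿cong⊗ (*⊗-congʳ q e)
      *⊗-congʳ q (⊗-cong e f)         = ⊗-cong e (L.*-congʳ f)
      *⊗-congʳ q (assoc⊗ t u w)       = assoc⊗ _ _ _
      *⊗-congʳ q (comm⊗ t u)          = comm⊗ _ _
      *⊗-congʳ q (identityˡ⊗ t)       = identityˡ⊗ _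
      *⊗-congʳ q (inverseˡ⊗ t)        = inverseˡ⊗ _
      *⊗-congʳ q (distribˡ⊗ x p p′)   =
        trans⊗ (⊗-cong ≈ᴹ-refl (L.distribʳ q p p′)) (distribˡ⊗ x _ _)
      *⊗-congʳ q (distribʳ⊗ x y p)    = distribʳ⊗ x y _
      *⊗-congʳ q (balanced x b p)     =
        trans⊗ (balanced x b _) (⊗-cong ≈ᴹ-refl (L.sym (L.*-assoc (localize b) p q)))

      *⊗-congˡ : ∀ t {p q} → p L.≈ q → t *⊗ p ≈⊗ t *⊗ q
      *⊗-congˡ (x ⊗ r)  e = ⊗-cong ≈ᴹ-refl (L.*-congˡ e)
      *⊗-congˡ 0⊗       e = refl⊗
      *⊗-congˡ (t +⊗ u) e = +-cong⊗ (*⊗-congˡ t e) (*⊗-congˡ u e)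
      *⊗-congˡ (-⊗ t)   e = -‿cong⊗ (*⊗-congˡ t e)

      ⊗-zeroʳ : ∀ x → x ⊗ L.0# ≈⊗ 0⊗
      ⊗-zeroʳ x = identityʳ-unique (x ⊗ L.0#) (x ⊗ L.0#)
        (trans⊗ (sym⊗ (distribˡ⊗ x L.0# L.0#)) (⊗-cong ≈ᴹ-refl (L.+-identityˡ L.0#)))

      *⊗-zeroʳ : ∀ t → t *⊗ L.0# ≈⊗ 0⊗
      *⊗-zeroʳ (x ⊗ p)  = trans⊗ (⊗-cong ≈ᴹ-refl (L.zeroʳ p)) (⊗-zeroʳ x)
      *⊗-zeroʳ 0⊗       = refl⊗
      *⊗-zeroʳ (t +⊗ u) = trans⊗ (+-cong⊗ (*⊗-zeroʳ t) (*⊗-zeroʳ u)) (identityˡ⊗ 0⊗)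
      *⊗-zeroʳ (-⊗ t)   = trans⊗ (-‿cong⊗ (*⊗-zeroʳ t)) ε⁻¹≈ε

      *⊗-distribˡ : ∀ t p q → t *⊗ (p L.+ q) ≈⊗ t *⊗ p +⊗ t *⊗ q
      *⊗-distribˡ (x ⊗ r)  p q = trans⊗ (⊗-cong ≈ᴹ-refl (L.distribˡ r p q)) (distribˡ⊗ x _ _)
      *⊗-distribˡ 0⊗       p q = sym⊗ (identityˡ⊗ 0⊗)
      *⊗-distribˡ (t +⊗ u) p q =
        trans⊗ (+-cong⊗ (*⊗-distribˡ t p q) (*⊗-distribˡ u p q)) (interchange _ _ _ _)
      *⊗-distribˡ (-⊗ t)   p q =
        trans⊗ (-‿cong⊗ (*⊗-distribˡ t p q)) (sym⊗ (⁻¹-∙-comm _ _))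

      *⊗-identityʳ : ∀ t → t *⊗ L.1# ≈⊗ t
      *⊗-identityʳ (x ⊗ p)  = ⊗-cong ≈ᴹ-refl (L.*-identityʳ p)
      *⊗-identityʳ 0⊗       = refl⊗
      *⊗-identityʳ (t +⊗ u) = +-cong⊗ (*⊗-identityʳ t) (*⊗-identityʳ u)
      *⊗-identityʳ (-⊗ t)   = -‿cong⊗ (*⊗-identityʳ t)

      *⊗-assoc : ∀ t p q → (t *⊗ p) *⊗ q ≈⊗ t *⊗ (p L.* q)
      *⊗-assoc (x ⊗ r)  p q = ⊗-cong ≈ᴹ-refl (L.*-assoc r p q)
      *⊗-assoc 0⊗       p q = refl⊗
      *⊗-assoc (t +⊗ u) p q = +-cong⊗ (*⊗-assoc t p q) (*⊗-assoc u p q)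
      *⊗-assoc (-⊗ t)   p q = -‿cong⊗ (*⊗-assoc t p q)

    abstract
      isTensorModule : IsModule L.commutativeRing _≈⊗_ _+⊗_ 0⊗ -⊗_ (λ q t → t *⊗ q) _*⊗_
      isTensorModule = IsModuleFromRight.isModule {commutativeRing = L.commutativeRing} record
            { isRightModule = record
              { isRightSemimodule = record
                { +ᴹ-isCommutativeMonoid = A.isCommutativeMonoid
                ; isPrerightSemimodule = record
                  { *ᵣ-cong      = λ {t} {u} {p} t≈u p≈q →
                      trans⊗ (*⊗-congʳ p t≈u) (*⊗-congˡ u p≈q)
                  ; *ᵣ-zeroʳ     = *⊗-zeroʳ
                  ; *ᵣ-distribˡ  = *⊗-distribˡ
                  ; *ᵣ-identityʳ = *⊗-identityʳ
                  ; *ᵣ-assoc     = *⊗-assoc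
                  ; *ᵣ-zeroˡ     = λ _ → refl⊗
                  ; *ᵣ-distribʳ  = λ _ _ _ → refl⊗
                  }
                }
              ; -ᴹ‿cong    = -‿cong⊗
              ; -ᴹ‿inverse = A.inverse
              }
            }

    tensorModule : Module L.commutativeRing (c ⊔ ℓ ⊔ m) (c ⊔ ℓ ⊔ m ⊔ ℓm)
    tensorModule = record { isModule = isTensorModule }

    localizeᴹ : Carrierᴹ → Tensor
    localizeᴹ x = x ⊗ L.1#

module LocalFormulas {c ℓ} (D : IntegralDomain c ℓ) where
  open FractionField D using (Q)
  open Divisibility D using (Γ)
  open Spectrum D
  open Localization D

  -- Scalars and values are global data, in Q(D) and Γ(D), that land in D_𝓜 and
  -- Γ(D_𝓜)⁺ at every 𝓜 ∈ C.
  LocalScalar : Constructible → Set (suc (c ⊔ ℓ))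
  LocalScalar C = Σ Q λ q → ∀ 𝓜 → 𝓜 ∈ ⟦ C ⟧ → InLocal 𝓜 q

  LocalValue : Constructible → Set (suc (c ⊔ ℓ))
  LocalValue C = Σ Γ λ δ → ∀ 𝓜 → 𝓜 ∈ ⟦ C ⟧ →
    Divisibility.Positive (localDomain 𝓜) (localizeΓ 𝓜 δ)

  LocalConjunction : Constructible → ℕ → Set (suc (c ⊔ ℓ))
  LocalConjunction C n = Conjunction (LocalScalar C) (LocalValue C) (Fin n)

  specialize : ∀ C (𝓜 : MSpec) → 𝓜 ∈ ⟦ C ⟧ → ∀ {n} → LocalConjunction C n →
               Conjunction (Local 𝓜) (Divisibility.Γ⁺ (localDomain 𝓜)) (Fin n)
  specialize C 𝓜 𝓜∈C = map (mapAtomic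
    (λ (q , q∈) → q , q∈ 𝓜 𝓜∈C)
    (λ (δ , δ∈) → localizeΓ 𝓜 δ , δ∈ 𝓜 𝓜∈C))

  -- (M_𝓜)_V ⊨ ψ(u_𝓜)
  LocalSat : ∀ {m ℓm} (M : Module (IntegralDomain.commutativeRing D) m ℓm) →
             ∀ C {n} → LocalConjunction C n → (𝓜 : MSpec) → 𝓜 ∈ ⟦ C ⟧ →
             (Fin n → Module.Carrierᴹ M) → Set (c ⊔ ℓ ⊔ m ⊔ ℓm)
  LocalSat M C ψ 𝓜 𝓜∈C u =
    ⟦_⟧ᶜ M𝓜 (canonicalV M𝓜) (specialize C 𝓜 𝓜∈C ψ) (localizeᴹ 𝓜 M ∘ u)
    where
    open Semantics (localDomain 𝓜) using (⟦_⟧ᶜ; canonicalV)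
    M𝓜 = tensorModule 𝓜 M

{-# OPTIONS --safe #-}
module Submission where

-- Reading V_δ(t) for δ = v(d) as ∃ z. z · d ≐ t turns φ(u) into the solvability in M of
-- a linear system A x = t(u).  Let h p be the cofactors of the entries of A with respect
-- to their gcd.  They generate the unit ideal, and where h p ∉ 𝓜 the entry p divides
-- every other entry, so p serves as a pivot.  Eliminating an unknown leaves a divisibility
-- condition on u and a smaller system.  The elimination thus branches over principal open
-- sets s ∉ 𝓜, and over each of them solvability becomes a conjunction of divisions
-- d ∣ t(u).  The scalars r for which A x = t(u) r is solvable form an ideal.  The local
-- conditions show that no maximal ideal contains it, so r = 1 belongs to it.

open import Algebra.Bundles using (CommutativeMonoid; CommutativeRing)
open import Algebra.Module.Bundles using (Module)
import Algebra.Module.Construct.TensorUnit as TensorUnit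
import Algebra.Properties.AbelianGroup as AbelianGroupProperties
import Algebra.Properties.CommutativeMonoid.Sum as Sum
import Algebra.Properties.CommutativeSemigroup as CommutativeSemigroupProperties
import Algebra.Properties.Group as GroupProperties
import Algebra.Properties.Ring as RingProperties
open import Axiom.ExcludedMiddle using (ExcludedMiddle)
open import Data.Fin.Base using (Fin; zero; suc; combine; remQuot)
open import Data.Fin.Properties using (remQuot-combine)
open import Data.List.Base using (List; []; _∷_; map; concat; tabulate; length; lookup)
open import Data.List.Membership.Propositional.Properties using (∈-lookup)
open import Data.List.Relation.Unary.All as All using (All; []; _∷_)
import Data.List.Relation.Unary.All.Properties as All
open import Data.List.Relation.Unary.Any as Any using (Any; here)
import Data.List.Relation.Unary.Any.Properties as Any
open import Data.Nat.Base as ℕ using (ℕ; zero; suc)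
open import Data.Product.Base using (Σ; ∃; _×_; _,_; proj₁; proj₂; uncurry)
open import Data.Sum.Base using (_⊎_; inj₁; inj₂; [_,_]′)
open import Data.Vec.Functional as Vector using (Vector; drop; insertAt; removeAt)
open import Data.Vec.Functional.Properties using (insertAt-lookup; insertAt-punchIn)
open import Function.Base using (_∘_; id)
open import Function.Bundles using (_⇔_; mk⇔; Equivalence)
import Level
open import Level using (Level; _⊔_; Lift; lift; lower)
open import Relation.Binary.Bundles using (Poset)
import Relation.Binary.PropositionalEquality.Core as ≡
import Relation.Binary.Reasoning.Setoid as SetoidReasoning
open import Relation.Nullary.Decidable
  using (Dec; yes; no; True; toWitness; fromWitness; decidable-stable)
open import Relation.Nullary.Negation.Core using (¬_; contradiction)
open import Relation.Unary using (Pred; _∈_; _∉_; _⊆_)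
open import Defs

-- Linear systems over a module

module LinearSystems {c ℓ m ℓm} {R : CommutativeRing c ℓ} (M : Module R m ℓm) where
  open CommutativeRing R hiding (zero)
  open Module M
  open Sum +ᴹ-commutativeMonoid using (sum; sum-cong-≋; ∑-distrib-+; sum-remove)
  open SetoidReasoning ≈ᴹ-setoid

  -- Coefficients are scalars and unknowns are module elements, so a row of a system over `M` is
  -- evaluated on module-valued vectors.
  dot : ∀ {n} → Vector Carrier n → Vector Carrierᴹ n → Carrierᴹ
  dot a x = sum λ l → x l *ᵣ a l

  *ᵣ-neg : ∀ x → x *ᵣ (- 1#) ≈ᴹ -ᴹ x
  *ᵣ-neg x = uniqueʳ‿-ᴹ x (x *ᵣ (- 1#)) (begin
    x +ᴹ x *ᵣ (- 1#)        ≈⟨ +ᴹ-congʳ (*ᵣ-identityʳ x) ⟨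
    x *ᵣ 1# +ᴹ x *ᵣ (- 1#)  ≈⟨ *ᵣ-distribˡ x 1# (- 1#) ⟨
    x *ᵣ (1# + - 1#)        ≈⟨ *ᵣ-congˡ (-‿inverseʳ 1#) ⟩
    x *ᵣ 0#                 ≈⟨ *ᵣ-zeroʳ x ⟩
    0ᴹ                      ∎)

  sum-0 : ∀ {n} {x : Vector Carrierᴹ n} → (∀ l → x l ≈ᴹ 0ᴹ) → sum x ≈ᴹ 0ᴹ
  sum-0 {zero}  x≈0 = ≈ᴹ-refl
  sum-0 {suc n} x≈0 =
    ≈ᴹ-trans (+ᴹ-cong (x≈0 zero) (sum-0 (x≈0 ∘ suc))) (+ᴹ-identityˡ 0ᴹ)

  sum-*ᵣ : ∀ {n} (x : Vector Carrierᴹ n) r → sum (λ l → x l *ᵣ r) ≈ᴹ sum x *ᵣ r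
  sum-*ᵣ {zero}  x r = ≈ᴹ-sym (*ᵣ-zeroˡ r)
  sum-*ᵣ {suc n} x r =
    ≈ᴹ-trans (+ᴹ-congˡ (sum-*ᵣ (x ∘ suc) r)) (≈ᴹ-sym (*ᵣ-distribʳ r (x zero) _))

  dot-congˡ : ∀ {n} {a b : Vector Carrier n} (x : Vector Carrierᴹ n) →
              (∀ l → a l ≈ b l) → dot a x ≈ᴹ dot b x
  dot-congˡ x a≈b = sum-cong-≋ λ l → *ᵣ-congˡ (a≈b l)

  dot-congʳ : ∀ {n} (a : Vector Carrier n) {x y : Vector Carrierᴹ n} →
              (∀ l → x l ≈ᴹ y l) → dot a x ≈ᴹ dot a y
  dot-congʳ a x≈y = sum-cong-≋ λ l → *ᵣ-congʳ (x≈y l)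

  dot-+ˡ : ∀ {n} (a b : Vector Carrier n) (x : Vector Carrierᴹ n) →
           dot (λ l → a l + b l) x ≈ᴹ dot a x +ᴹ dot b x
  dot-+ˡ a b x = ≈ᴹ-trans (sum-cong-≋ λ l → *ᵣ-distribˡ (x l) (a l) (b l))
                          (∑-distrib-+ (λ l → x l *ᵣ a l) (λ l → x l *ᵣ b l))

  dot-+ʳ : ∀ {n} (a : Vector Carrier n) (x y : Vector Carrierᴹ n) →
           dot a (λ l → x l +ᴹ y l) ≈ᴹ dot a x +ᴹ dot a y
  dot-+ʳ a x y = ≈ᴹ-trans (sum-cong-≋ λ l → *ᵣ-distribʳ (a l) (x l) (y l))
                          (∑-distrib-+ (λ l → x l *ᵣ a l) (λ l → y l *ᵣ a l))

  dot-*ˡ : ∀ {n} (a : Vector Carrier n) (x : Vector Carrierᴹ n) r →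
           dot (λ l → a l * r) x ≈ᴹ dot a x *ᵣ r
  dot-*ˡ a x r = ≈ᴹ-trans (sum-cong-≋ λ l → ≈ᴹ-sym (*ᵣ-assoc (x l) (a l) r))
                          (sum-*ᵣ (λ l → x l *ᵣ a l) r)

  dot-*ʳ : ∀ {n} (a : Vector Carrier n) (x : Vector Carrierᴹ n) r →
           dot a (λ l → x l *ᵣ r) ≈ᴹ dot a x *ᵣ r
  dot-*ʳ a x r = ≈ᴹ-trans (sum-cong-≋ λ l → *ᵣ-comm (x l) r (a l))
                          (sum-*ᵣ (λ l → x l *ᵣ a l) r)

  dot-0ˡ : ∀ {n} {a : Vector Carrier n} (x : Vector Carrierᴹ n) →
           (∀ l → a l ≈ 0#) → dot a x ≈ᴹ 0ᴹ
  dot-0ˡ x a≈0 = sum-0 λ l → ≈ᴹ-trans (*ᵣ-congˡ (a≈0 l)) (*ᵣ-zeroʳ (x l))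

  dot-0ʳ : ∀ {n} (a : Vector Carrier n) {x : Vector Carrierᴹ n} →
           (∀ l → x l ≈ᴹ 0ᴹ) → dot a x ≈ᴹ 0ᴹ
  dot-0ʳ a x≈0 = sum-0 λ l → ≈ᴹ-trans (*ᵣ-congʳ (x≈0 l)) (*ᵣ-zeroˡ (a l))

  unit : ∀ {n} → Fin n → Vector Carrier n
  unit zero    = 1# Vector.∷ λ _ → 0#
  unit (suc j) = 0# Vector.∷ unit j

  dot-unit : ∀ {n} (j : Fin n) (x : Vector Carrierᴹ n) → dot (unit j) x ≈ᴹ x j
  dot-unit zero    x =
    ≈ᴹ-trans (+ᴹ-cong (*ᵣ-identityʳ _) (dot-0ˡ (x ∘ suc) λ _ → refl)) (+ᴹ-identityʳ _)
  dot-unit (suc j) x =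
    ≈ᴹ-trans (+ᴹ-cong (*ᵣ-zeroʳ _) (dot-unit j (x ∘ suc))) (+ᴹ-identityˡ _)

  dot-insertAt : ∀ {n} (a : Vector Carrier (suc n)) (x : Vector Carrierᴹ n) j w →
                 dot a (insertAt x j w) ≈ᴹ w *ᵣ a j +ᴹ dot (removeAt a j) x
  dot-insertAt a x j w =
    ≈ᴹ-trans (sum-remove {i = j} (λ l → insertAt x j w l *ᵣ a l))
      (+ᴹ-cong (*ᵣ-congʳ (≈ᴹ-reflexive (insertAt-lookup x j w)))
               (sum-cong-≋ λ l → *ᵣ-congʳ (≈ᴹ-reflexive (insertAt-punchIn x j w l))))

  Solvable : ∀ {e n} → (Fin e → Vector Carrier n) → (Fin e → Carrierᴹ) → Set (m ⊔ ℓm)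
  Solvable {n = n} a T = Σ (Vector Carrierᴹ n) λ x → ∀ k → dot (a k) x ≈ᴹ T k

  solvable-cong : ∀ {e n} (a : Fin e → Vector Carrier n) {T T′} →
                  (∀ k → T k ≈ᴹ T′ k) → Solvable a T → Solvable a T′
  solvable-cong a T≈T′ (x , ax≈T) = x , λ k → ≈ᴹ-trans (ax≈T k) (T≈T′ k)

  solvable-0 : ∀ {e n} (a : Fin e → Vector Carrier n) → Solvable a (λ _ → 0ᴹ)
  solvable-0 a = (λ _ → 0ᴹ) , λ k → dot-0ʳ (a k) λ _ → ≈ᴹ-refl

  solvable-+ : ∀ {e n} (a : Fin e → Vector Carrier n) {T T′} →
               Solvable a T → Solvable a T′ → Solvable a (λ k → T k +ᴹ T′ k)
  solvable-+ a (x , ax≈T) (y , ay≈T′) = (λ l → x l +ᴹ y l) ,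
    λ k → ≈ᴹ-trans (dot-+ʳ (a k) x y) (+ᴹ-cong (ax≈T k) (ay≈T′ k))

  solvable-* : ∀ {e n} (a : Fin e → Vector Carrier n) {T} r →
               Solvable a T → Solvable a (λ k → T k *ᵣ r)
  solvable-* a r (x , ax≈T) = (λ l → x l *ᵣ r) ,
    λ k → ≈ᴹ-trans (dot-*ʳ (a k) x r) (*ᵣ-congʳ (ax≈T k))

  _∣ᴹ_ : Carrier → Carrierᴹ → Set (m ⊔ ℓm)
  d ∣ᴹ y = ∃ λ z → z *ᵣ d ≈ᴹ y

  -- Fraction-free Gauss step: s times row k minus g k times the pivot row, with the cleared column
  -- j dropped. All e equations are kept; only the number of unknowns falls.
  eliminate : ∀ {e n} → (Fin e → Vector Carrier (suc n)) → Fin e → Fin (suc n) →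
              Carrier → (Fin e → Carrier) → Fin e → Vector Carrier n
  eliminate a i j s g k = removeAt (λ l → a k l * s + a i l * - g k) j

  -- s and g are cofactors of the pivot a i j: the column of the pivot satisfies
  -- a k j · s = a i j · g k, and its row a i l · s = h l · a i j.
  module Pivot {e n} (a : Fin e → Vector Carrier (suc n)) (i : Fin e) (j : Fin (suc n))
               (s : Carrier) (g : Fin e → Carrier) (h : Vector Carrier (suc n))
               (column : ∀ k → a k j * s ≈ a i j * g k)
               (row : ∀ l → a i l * s ≈ h l * a i j)
               (T : Fin e → Carrierᴹ) where

    private
      T′ : Fin e → Carrierᴹ
      T′ k = T k *ᵣ s +ᴹ T i *ᵣ (- g k)

      -- Summing the identity `row` over x: up to the factor s, the pivot divides the whole left
      -- side of equation i. This is the source of the divisibility condition on `T i`.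
      pivot-divides : ∀ x → dot (a i) x *ᵣ s ≈ᴹ dot h x *ᵣ a i j
      pivot-divides x = begin
        dot (a i) x *ᵣ s            ≈⟨ dot-*ˡ (a i) x s ⟨
        dot (λ l → a i l * s) x     ≈⟨ dot-congˡ x row ⟩
        dot (λ l → h l * a i j) x   ≈⟨ dot-*ˡ h x (a i j) ⟩
        dot h x *ᵣ a i j            ∎

      dot-combine : ∀ k x → dot (λ l → a k l * s + a i l * - g k) x ≈ᴹ
                            dot (a k) x *ᵣ s +ᴹ dot (a i) x *ᵣ (- g k)
      dot-combine k x = ≈ᴹ-trans (dot-+ˡ (λ l → a k l * s) (λ l → a i l * - g k) x)
        (+ᴹ-cong (dot-*ˡ (a k) x s) (dot-*ˡ (a i) x (- g k)))

      column-vanishes : ∀ k → a k j * s + a i j * - g k ≈ 0#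
      column-vanishes k =
        trans (+-congʳ (column k)) (trans (sym (distribˡ (a i j) (g k) (- g k)))
          (trans (*-congˡ (-‿inverseʳ (g k))) (zeroʳ (a i j))))

      -- The value w put back at position j is arbitrary, because its coefficient in the combined
      -- row vanishes.
      dot-eliminate : ∀ k x w → dot (eliminate a i j s g k) x ≈ᴹ
                      dot (a k) (insertAt x j w) *ᵣ s +ᴹ dot (a i) (insertAt x j w) *ᵣ (- g k)
      dot-eliminate k x w = begin
        dot (eliminate a i j s g k) x             ≈⟨ +ᴹ-identityˡ _ ⟨
        0ᴹ +ᴹ dot (eliminate a i j s g k) x       ≈⟨ +ᴹ-congʳ (*ᵣ-zeroʳ w) ⟨
        w *ᵣ 0# +ᴹ dot (eliminate a i j s g k) x  ≈⟨ +ᴹ-congʳ (*ᵣ-congˡ (column-vanishes k)) ⟨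
        w *ᵣ (a k j * s + a i j * - g k) +ᴹ dot (eliminate a i j s g k) x
          ≈⟨ dot-insertAt (λ l → a k l * s + a i l * - g k) x j w ⟨
        dot (λ l → a k l * s + a i l * - g k) (insertAt x j w)
          ≈⟨ dot-combine k (insertAt x j w) ⟩
        dot (a k) (insertAt x j w) *ᵣ s +ᴹ dot (a i) (insertAt x j w) *ᵣ (- g k) ∎

    eliminate-solvable : Solvable a T → a i j ∣ᴹ (T i *ᵣ s) × Solvable (eliminate a i j s g) T′
    eliminate-solvable (x , ax≈T) =
      (dot h x , ≈ᴹ-trans (≈ᴹ-sym (pivot-divides x)) (*ᵣ-congʳ (ax≈T i))) ,
      removeAt x j , λ k → begin
        dot (eliminate a i j s g k) (removeAt x j)             ≈⟨ +ᴹ-identityˡ _ ⟨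
        0ᴹ +ᴹ dot (eliminate a i j s g k) (removeAt x j)       ≈⟨ +ᴹ-congʳ (*ᵣ-zeroʳ (x j)) ⟨
        x j *ᵣ 0# +ᴹ dot (eliminate a i j s g k) (removeAt x j)
          ≈⟨ +ᴹ-congʳ (*ᵣ-congˡ (column-vanishes k)) ⟨
        x j *ᵣ (a k j * s + a i j * - g k) +ᴹ dot (eliminate a i j s g k) (removeAt x j)
          ≈⟨ sum-remove {i = j} (λ l → x l *ᵣ (a k l * s + a i l * - g k)) ⟨
        dot (λ l → a k l * s + a i l * - g k) x                ≈⟨ dot-combine k x ⟩
        dot (a k) x *ᵣ s +ᴹ dot (a i) x *ᵣ (- g k)
          ≈⟨ +ᴹ-cong (*ᵣ-congʳ (ax≈T k)) (*ᵣ-congʳ (ax≈T i)) ⟩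
        T′ k ∎

    -- With y extended by 0 at j, the solution is (y · s r′ + (z · r − (h · y) · r′) eⱼ) · s.
    solvable-eliminate : ∀ {r r′} → Solvable (eliminate a i j s g) (λ k → T′ k *ᵣ r) →
                         a i j ∣ᴹ (T i *ᵣ s *ᵣ r′) →
                         Solvable a (λ k → T k *ᵣ (s * (r * (s * r′))))
    solvable-eliminate {r} {r′} (y , Ay≈T′) (z , za≈T) =
      (λ l → (y⁺ l *ᵣ (s * r′) +ᴹ eⱼ l) *ᵣ s) , λ k → begin
        dot (a k) (λ l → (y⁺ l *ᵣ (s * r′) +ᴹ eⱼ l) *ᵣ s)
          ≈⟨ dot-*ʳ (a k) (λ l → y⁺ l *ᵣ (s * r′) +ᴹ eⱼ l) s ⟩
        dot (a k) (λ l → y⁺ l *ᵣ (s * r′) +ᴹ eⱼ l) *ᵣ s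
          ≈⟨ *ᵣ-congʳ (dot-+ʳ (a k) (λ l → y⁺ l *ᵣ (s * r′)) eⱼ) ⟩
        (dot (a k) (λ l → y⁺ l *ᵣ (s * r′)) +ᴹ dot (a k) eⱼ) *ᵣ s
          ≈⟨ *ᵣ-congʳ (+ᴹ-cong (dot-*ʳ (a k) y⁺ (s * r′)) (dot-eⱼ k)) ⟩
        (dot (a k) y⁺ *ᵣ (s * r′) +ᴹ w *ᵣ a k j) *ᵣ s
          ≈⟨ *ᵣ-distribʳ s _ _ ⟩
        dot (a k) y⁺ *ᵣ (s * r′) *ᵣ s +ᴹ w *ᵣ a k j *ᵣ s
          ≈⟨ +ᴹ-cong (*ᵣ-comm _ (s * r′) s) (pivot-row k) ⟩
        dot (a k) y⁺ *ᵣ s *ᵣ (s * r′) +ᴹ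
          (dot (a i) y⁺ *ᵣ (- g k) *ᵣ (s * r′) +ᴹ T i *ᵣ g k *ᵣ r *ᵣ (s * r′))
          ≈⟨ +ᴹ-assoc _ _ _ ⟨
        (dot (a k) y⁺ *ᵣ s *ᵣ (s * r′) +ᴹ dot (a i) y⁺ *ᵣ (- g k) *ᵣ (s * r′)) +ᴹ
          T i *ᵣ g k *ᵣ r *ᵣ (s * r′)
          ≈⟨ +ᴹ-congʳ (*ᵣ-distribʳ (s * r′) _ _) ⟨
        (dot (a k) y⁺ *ᵣ s +ᴹ dot (a i) y⁺ *ᵣ (- g k)) *ᵣ (s * r′) +ᴹ T i *ᵣ g k *ᵣ r *ᵣ (s * r′)
          ≈⟨ +ᴹ-congʳ (*ᵣ-congʳ (≈ᴹ-trans (≈ᴹ-sym (dot-eliminate k y 0ᴹ)) (Ay≈T′ k))) ⟩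
        T′ k *ᵣ r *ᵣ (s * r′) +ᴹ T i *ᵣ g k *ᵣ r *ᵣ (s * r′)
          ≈⟨ *ᵣ-distribʳ (s * r′) _ _ ⟨
        (T′ k *ᵣ r +ᴹ T i *ᵣ g k *ᵣ r) *ᵣ (s * r′)
          ≈⟨ *ᵣ-congʳ (≈ᴹ-trans (≈ᴹ-sym (*ᵣ-distribʳ r _ _)) (*ᵣ-congʳ (cancel k))) ⟩
        T k *ᵣ s *ᵣ r *ᵣ (s * r′)
          ≈⟨ ≈ᴹ-trans (*ᵣ-assoc _ r (s * r′)) (*ᵣ-assoc (T k) s _) ⟩
        T k *ᵣ (s * (r * (s * r′))) ∎
      where
      y⁺ eⱼ : Vector Carrierᴹ (suc n)
      w : Carrierᴹ
      y⁺ = insertAt y j 0ᴹ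
      w  = z *ᵣ r +ᴹ dot h y⁺ *ᵣ (- r′)
      eⱼ = insertAt (λ _ → 0ᴹ) j w

      dot-eⱼ : ∀ k → dot (a k) eⱼ ≈ᴹ w *ᵣ a k j
      dot-eⱼ k = begin
        dot (a k) eⱼ                                           ≈⟨ dot-insertAt (a k) (λ _ → 0ᴹ) j w ⟩
        w *ᵣ a k j +ᴹ dot (removeAt (a k) j) (λ _ → 0ᴹ)
          ≈⟨ +ᴹ-congˡ (dot-0ʳ (removeAt (a k) j) λ _ → ≈ᴹ-refl) ⟩
        w *ᵣ a k j +ᴹ 0ᴹ                                       ≈⟨ +ᴹ-identityʳ _ ⟩
        w *ᵣ a k j                                             ∎

      neg-move : ∀ x b → x *ᵣ (- b) ≈ᴹ x *ᵣ b *ᵣ (- 1#)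
      neg-move x b = ≈ᴹ-trans (*ᵣ-congˡ (sym (trans (*-comm b (- 1#)) (-1*x≈-x b))))
                              (≈ᴹ-sym (*ᵣ-assoc x b (- 1#)))
        where open RingProperties ring using (-1*x≈-x)

      -- By `column`, the factor s turns a k j into a i j · g k, so only w · a i j matters. The
      -- choice of w makes it T i · (s r r′) - (a i · y⁺) · (s r′), exactly what equation i lacks
      -- after y⁺ is scaled by s r′.
      pivot-row : ∀ k → w *ᵣ a k j *ᵣ s ≈ᴹ
                  dot (a i) y⁺ *ᵣ (- g k) *ᵣ (s * r′) +ᴹ T i *ᵣ g k *ᵣ r *ᵣ (s * r′)
      pivot-row k = begin
        w *ᵣ a k j *ᵣ s                    ≈⟨ *ᵣ-assoc w (a k j) s ⟩
        w *ᵣ (a k j * s)                   ≈⟨ *ᵣ-congˡ (column k) ⟩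
        w *ᵣ (a i j * g k)                 ≈⟨ *ᵣ-assoc w (a i j) (g k) ⟨
        w *ᵣ a i j *ᵣ g k                  ≈⟨ *ᵣ-congʳ (*ᵣ-distribʳ (a i j) _ _) ⟩
        (z *ᵣ r *ᵣ a i j +ᴹ dot h y⁺ *ᵣ (- r′) *ᵣ a i j) *ᵣ g k
          ≈⟨ *ᵣ-distribʳ (g k) _ _ ⟩
        z *ᵣ r *ᵣ a i j *ᵣ g k +ᴹ dot h y⁺ *ᵣ (- r′) *ᵣ a i j *ᵣ g k
          ≈⟨ +ᴹ-cong pivot-z pivot-y ⟩
        T i *ᵣ g k *ᵣ r *ᵣ (s * r′) +ᴹ dot (a i) y⁺ *ᵣ (- g k) *ᵣ (s * r′)
          ≈⟨ +ᴹ-comm _ _ ⟩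
        dot (a i) y⁺ *ᵣ (- g k) *ᵣ (s * r′) +ᴹ T i *ᵣ g k *ᵣ r *ᵣ (s * r′) ∎
        where
        pivot-z : z *ᵣ r *ᵣ a i j *ᵣ g k ≈ᴹ T i *ᵣ g k *ᵣ r *ᵣ (s * r′)
        pivot-z = begin
          z *ᵣ r *ᵣ a i j *ᵣ g k        ≈⟨ *ᵣ-congʳ (*ᵣ-comm z r (a i j)) ⟩
          z *ᵣ a i j *ᵣ r *ᵣ g k        ≈⟨ *ᵣ-congʳ (*ᵣ-congʳ za≈T) ⟩
          T i *ᵣ s *ᵣ r′ *ᵣ r *ᵣ g k    ≈⟨ *ᵣ-comm _ r (g k) ⟩
          T i *ᵣ s *ᵣ r′ *ᵣ g k *ᵣ r    ≈⟨ *ᵣ-congʳ (*ᵣ-congʳ (*ᵣ-assoc (T i) s r′)) ⟩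
          T i *ᵣ (s * r′) *ᵣ g k *ᵣ r   ≈⟨ *ᵣ-congʳ (*ᵣ-comm (T i) (s * r′) (g k)) ⟩
          T i *ᵣ g k *ᵣ (s * r′) *ᵣ r   ≈⟨ *ᵣ-comm _ (s * r′) r ⟩
          T i *ᵣ g k *ᵣ r *ᵣ (s * r′)   ∎

        pivot-y : dot h y⁺ *ᵣ (- r′) *ᵣ a i j *ᵣ g k ≈ᴹ dot (a i) y⁺ *ᵣ (- g k) *ᵣ (s * r′)
        pivot-y = begin
          dot h y⁺ *ᵣ (- r′) *ᵣ a i j *ᵣ g k          ≈⟨ *ᵣ-congʳ (*ᵣ-comm _ (- r′) (a i j)) ⟩
          dot h y⁺ *ᵣ a i j *ᵣ (- r′) *ᵣ g k          ≈⟨ *ᵣ-congʳ (*ᵣ-congʳ (pivot-divides y⁺)) ⟨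
          dot (a i) y⁺ *ᵣ s *ᵣ (- r′) *ᵣ g k          ≈⟨ *ᵣ-congʳ (neg-move _ r′) ⟩
          dot (a i) y⁺ *ᵣ s *ᵣ r′ *ᵣ (- 1#) *ᵣ g k    ≈⟨ *ᵣ-comm _ (- 1#) (g k) ⟩
          dot (a i) y⁺ *ᵣ s *ᵣ r′ *ᵣ g k *ᵣ (- 1#)    ≈⟨ neg-move _ (g k) ⟨
          dot (a i) y⁺ *ᵣ s *ᵣ r′ *ᵣ (- g k)          ≈⟨ *ᵣ-congʳ (*ᵣ-assoc _ s r′) ⟩
          dot (a i) y⁺ *ᵣ (s * r′) *ᵣ (- g k)         ≈⟨ *ᵣ-comm _ (s * r′) (- g k) ⟩
          dot (a i) y⁺ *ᵣ (- g k) *ᵣ (s * r′)         ∎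

      cancel : ∀ k → T′ k +ᴹ T i *ᵣ g k ≈ᴹ T k *ᵣ s
      cancel k = begin
        T k *ᵣ s +ᴹ T i *ᵣ (- g k) +ᴹ T i *ᵣ g k     ≈⟨ +ᴹ-assoc _ _ _ ⟩
        T k *ᵣ s +ᴹ (T i *ᵣ (- g k) +ᴹ T i *ᵣ g k)   ≈⟨ +ᴹ-congˡ (*ᵣ-distribˡ (T i) (- g k) (g k)) ⟨
        T k *ᵣ s +ᴹ T i *ᵣ (- g k + g k)             ≈⟨ +ᴹ-congˡ (*ᵣ-congˡ (-‿inverseˡ (g k))) ⟩
        T k *ᵣ s +ᴹ T i *ᵣ 0#                        ≈⟨ +ᴹ-congˡ (*ᵣ-zeroʳ (T i)) ⟩
        T k *ᵣ s +ᴹ 0ᴹ                               ≈⟨ +ᴹ-identityʳ _ ⟩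
        T k *ᵣ s                                     ∎

-- Maximal ideals and cofactors

module MaximalIdeals (em : ∀ {a} → ExcludedMiddle a) (zorn : ∀ {a ℓ₁ ℓ₂ p} → Zorn a ℓ₁ ℓ₂ p)
                     {c ℓ} (D : IntegralDomain c ℓ) where
  open IntegralDomain D hiding (zero)
  open Spectrum D

  private
    variable
      a p : Level

  -- Excluded middle lowers an ideal of any level to the level at which MSpec lives.
  Resize : Set a → Set (c ⊔ ℓ)
  Resize P = Lift (c ⊔ ℓ) (True (em {P = P}))

  resize : {P : Set a} → P → Resize P
  resize = lift ∘ fromWitness

  unresize : {P : Set a} → Resize P → P
  unresize = toWitness ∘ lower

  resize-isIdeal : {J : Pred Carrier p} → IsIdeal J → IsIdeal (Resize ∘ J)
  resize-isIdeal J-isIdeal = record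
    { resp     = λ x≈y x∈ → resize (resp x≈y (unresize x∈))
    ; 0∈       = resize 0∈
    ; +-closed = λ x∈ y∈ → resize (+-closed (unresize x∈) (unresize y∈))
    ; *-closed = λ r x∈ → resize (*-closed r (unresize x∈))
    }
    where open IsIdeal J-isIdeal

  module _ {I : Pred Carrier (c ⊔ ℓ)} (I-isIdeal : IsIdeal I) (1∉I : 1# ∉ I) where

    private
      Above : Set (Level.suc (c ⊔ ℓ))
      Above = Σ (Pred Carrier (c ⊔ ℓ)) λ J → IsIdeal J × 1# ∉ J × I ⊆ J

      inclusion : Poset _ _ _
      inclusion = record
        { Carrier = Above
        ; _≈_ = λ J K → proj₁ J ⊆ proj₁ K × proj₁ K ⊆ proj₁ J
        ; _≤_ = λ J K → proj₁ J ⊆ proj₁ K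
        ; isPartialOrder = record
          { isPreorder = record
            { isEquivalence = record
              { refl  = id , id
              ; sym   = λ (J⊆K , K⊆J) → K⊆J , J⊆K
              ; trans = λ (J⊆K , K⊆J) (K⊆L , L⊆K) → (λ x∈ → K⊆L (J⊆K x∈)) , (λ x∈ → K⊆J (L⊆K x∈))
              }
            ; reflexive = proj₁
            ; trans = λ J⊆K K⊆L x∈ → K⊆L (J⊆K x∈)
            }
          ; antisym = _,_
          }
        }

      -- I is joined to the union so that the empty chain is bounded too.
      module Union (C : Pred Above (c ⊔ ℓ)) (chain : IsChain inclusion C) where
        U : Pred Carrier (Level.suc (c ⊔ ℓ))
        U x = x ∈ I ⊎ ∃ λ J → J ∈ C × x ∈ proj₁ J

        U-+ : ∀ {x y} → x ∈ U → y ∈ U → x + y ∈ U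
        U-+ (inj₁ x∈I) (inj₁ y∈I) = inj₁ (IsIdeal.+-closed I-isIdeal x∈I y∈I)
        U-+ (inj₁ x∈I) (inj₂ (J@(_ , J-isIdeal , _ , I⊆J) , J∈C , y∈J)) =
          inj₂ (J , J∈C , IsIdeal.+-closed J-isIdeal (I⊆J x∈I) y∈J)
        U-+ (inj₂ (J@(_ , J-isIdeal , _ , I⊆J) , J∈C , x∈J)) (inj₁ y∈I) =
          inj₂ (J , J∈C , IsIdeal.+-closed J-isIdeal x∈J (I⊆J y∈I))
        U-+ (inj₂ (J@(_ , J-isIdeal , _) , J∈C , x∈J)) (inj₂ (K@(_ , K-isIdeal , _) , K∈C , y∈K)) =
          [ (λ J⊆K → inj₂ (K , K∈C , IsIdeal.+-closed K-isIdeal (J⊆K x∈J) y∈K))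
          , (λ K⊆J → inj₂ (J , J∈C , IsIdeal.+-closed J-isIdeal x∈J (K⊆J y∈K)))
          ]′ (chain {J} {K} J∈C K∈C)

        U-isIdeal : IsIdeal U
        U-isIdeal = record
          { resp = λ
              { x≈y (inj₁ x∈I) → inj₁ (IsIdeal.resp I-isIdeal x≈y x∈I)
              ; x≈y (inj₂ (J , J∈C , x∈J)) →
                  inj₂ (J , J∈C , IsIdeal.resp (proj₁ (proj₂ J)) x≈y x∈J)
              }
          ; 0∈ = inj₁ (IsIdeal.0∈ I-isIdeal)
          ; +-closed = U-+
          ; *-closed = λ
              { r (inj₁ x∈I) → inj₁ (IsIdeal.*-closed I-isIdeal r x∈I)
              ; r (inj₂ (J , J∈C , x∈J)) →
                  inj₂ (J , J∈C , IsIdeal.*-closed (proj₁ (proj₂ J)) r x∈J)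
              }
          }

        1∉U : 1# ∉ U
        1∉U (inj₁ 1∈I) = 1∉I 1∈I
        1∉U (inj₂ ((_ , _ , 1∉J , _) , _ , 1∈J)) = 1∉J 1∈J

        bound : ∃ λ (b : Above) → ∀ {J} → J ∈ C → proj₁ J ⊆ proj₁ b
        -- The union quantifies over ideals and so lives one universe too high; `Resize` brings it
        -- back into `Above`.
        bound = ((Resize ∘ U) , resize-isIdeal U-isIdeal , (λ 1∈U → 1∉U (unresize 1∈U)) ,
                 λ {x} x∈I → resize {P = U x} (inj₁ x∈I)) ,
          λ {J} J∈C {x} x∈J → resize {P = U x} (inj₂ (J , J∈C , x∈J))

    maximal-above : ∃ λ 𝓜 → I ⊆ MSpec.ideal 𝓜
    maximal-above = record
      { ideal   = m
      ; isIdeal = m-isIdeal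
      ; proper  = 1∉m
      -- A proper ideal over m also contains I, so it belongs to the poset in which m is maximal.
      ; maximal = λ {J} J-isIdeal 1∉J m⊆J →
          proj₂ (m-maximal {J , J-isIdeal , 1∉J , λ x∈I → m⊆J (I⊆m x∈I)} m⊆J)
      } , I⊆m
      where
      maximal-element = zorn inclusion Union.bound
      m = proj₁ (proj₁ maximal-element)
      m-isIdeal = proj₁ (proj₂ (proj₁ maximal-element))
      1∉m = proj₁ (proj₂ (proj₂ (proj₁ maximal-element)))
      I⊆m = proj₂ (proj₂ (proj₂ (proj₁ maximal-element)))
      m-maximal = proj₂ maximal-element

  -- An ideal without 1 would lie in some maximal ideal 𝓜, against its having an element outside 𝓜.
  local-global : {J : Pred Carrier p} → IsIdeal J →
                 (∀ 𝓜 → ∃ λ r → r ∉ MSpec.ideal 𝓜 × r ∈ J) → 1# ∈ J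
  local-global {J = J} J-isIdeal avoids with em {P = 1# ∈ J}
  ... | yes 1∈J = 1∈J
  ... | no 1∉J with 𝓜 , J⊆𝓜 ← maximal-above (resize-isIdeal J-isIdeal) (λ 1∈J → 1∉J (unresize 1∈J))
               with r , r∉𝓜 , r∈J ← avoids 𝓜 = contradiction (J⊆𝓜 (resize {P = J r} r∈J)) r∉𝓜

module Cofactors (em : ∀ {a} → ExcludedMiddle a) {c ℓ} (B : BezoutDomain c ℓ) where
  open BezoutDomain B hiding (zero)
  open Spectrum integralDomain
  -- The ring is taken as a module over itself, so that `dot` becomes the scalar product of two
  -- vectors of scalars.
  open LinearSystems (TensorUnit.⟨module⟩ {R = commutativeRing})
    using (dot; unit; dot-unit; dot-congˡ; dot-*ˡ)

  dot-∈ : ∀ {p} {J : Pred Carrier p} → IsIdeal J → ∀ {n} (a x : Vector Carrier n) →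
          (∀ l → a l ∈ J) → dot a x ∈ J
  dot-∈ J-isIdeal {zero}  a x a∈ = IsIdeal.0∈ J-isIdeal
  dot-∈ J-isIdeal {suc n} a x a∈ = IsIdeal.+-closed J-isIdeal
    (IsIdeal.*-closed J-isIdeal (x zero) (a∈ zero)) (dot-∈ J-isIdeal (a ∘ suc) (x ∘ suc) (a∈ ∘ suc))

  dot-comm : ∀ {n} (a x : Vector Carrier n) → dot a x ≈ dot x a
  dot-comm {zero}  a x = refl
  dot-comm {suc n} a x = +-cong (*-comm _ _) (dot-comm (a ∘ suc) (x ∘ suc))

  -- The quotients of g by its gcd, kept only through cross multiplication and unimodularity. The
  -- latter is put in its local form: at each 𝓜 some h p is a unit of the localization.
  Cofactors : ∀ {n} → Vector Carrier n → Set (Level.suc (c ⊔ ℓ))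
  Cofactors {n} g = Σ (Vector Carrier n) λ h →
    (∀ p q → g q * h p ≈ g p * h q) × (∀ 𝓜 → ∃ λ p → h p ∉ MSpec.ideal 𝓜)

  -- If d generates the ideal of the g p = h p · d and d ≉ 0, then d = Σ r p · g p
  -- cancels to 1 = Σ r p · h p, so no maximal ideal contains every h p.
  zero-or-cofactors : ∀ {n} (g : Vector Carrier n) → (∀ p → g p ≈ 0#) ⊎ Cofactors g
  zero-or-cofactors {n} g with d , Span-g⇔Span-d ← isBezout g = result em
    where
    multiple : ∀ p → ∃ λ h → g p ≈ h * d
    -- The p-th unit vector witnesses that g p lies in the span of g; the span of the single d
    -- yields h · d + 0.
    multiple p with h , g≈hd+0 ← Equivalence.to (Span-g⇔Span-d (g p))
                      (unit p , trans (sym (dot-unit p g)) (dot-comm (unit p) g)) =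
      h zero , trans g≈hd+0 (+-identityʳ _)

    h : Vector Carrier n
    h p = proj₁ (multiple p)

    g≈hd : ∀ p → g p ≈ h p * d
    g≈hd p = proj₂ (multiple p)

    1∈Span-h : ¬ d ≈ 0# → ∃ λ r → dot h r ≈ 1#
    1∈Span-h d≉0 with r , d≈gr ← Equivalence.from (Span-g⇔Span-d d)
                        ((λ _ → 1#) , sym (trans (+-identityʳ _) (*-identityˡ d))) =
      r , *-cancelʳ d≉0 (trans (sym (dot-*ˡ h r d)) (trans (sym (dot-congˡ r g≈hd))
            (trans (sym d≈gr) (sym (*-identityˡ d)))))

    swap : ∀ p q → g q * h p ≈ g p * h q
    swap p q = trans (*-congʳ (g≈hd q)) (trans (xy∙z≈zy∙x (h q) d (h p)) (*-congʳ (sym (g≈hd p))))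
      where open CommutativeSemigroupProperties *-commutativeSemigroup using (xy∙z≈zy∙x)

    result : Dec (d ≈ 0#) → (∀ p → g p ≈ 0#) ⊎ Cofactors g
    result (yes d≈0) = inj₁ λ p → trans (g≈hd p) (trans (*-congˡ d≈0) (zeroʳ (h p)))
    result (no d≉0)  = inj₂ (h , swap , λ 𝓜 → decidable-stable em λ all∈ →
      let open MSpec 𝓜 ; r , hr≈1 = 1∈Span-h d≉0 in
      proper (resp hr≈1 (dot-∈ isIdeal h r λ p → decidable-stable em λ h∉ → all∈ (p , h∉))))

-- Denominators in the localization

module Denominators {c ℓ m ℓm} (D : IntegralDomain c ℓ) (𝓜 : Spectrum.MSpec D)
                    (M : Module (IntegralDomain.commutativeRing D) m ℓm) where
  open IntegralDomain D
  open FractionField D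
  open Spectrum.MSpec 𝓜 using (ideal; *-∉; proper)
  open Localization D 𝓜
  open Module M
  open LinearSystems M using (_∣ᴹ_; *ᵣ-neg)
  private
    module QD = IntegralDomain fractionField
    module L = IntegralDomain localDomain
  open CommutativeSemigroupProperties QD.*-commutativeSemigroup using (x∙yz≈y∙xz)

  ι-* : ∀ x y → ι (x * y) ≈Q ι x *Q ι y
  ι-* x y = cross (*-congˡ (*-identityˡ 1#))

  ι-+ : ∀ x y → ι (x + y) ≈Q ι x +Q ι y
  ι-+ x y = cross (*-cong (sym (+-cong (*-identityʳ x) (*-identityʳ y))) (*-identityˡ 1#))

  ι-injective : ∀ {x y} → ι x ≈Q ι y → x ≈ y
  ι-injective (cross x1≈y1) = trans (sym (*-identityʳ _)) (trans x1≈y1 (*-identityʳ _))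

  ι-cong : ∀ {x y} → x ≈ y → ι x ≈Q ι y
  ι-cong x≈y = cross (*-congʳ x≈y)

  -- s clears all the denominators in t, and s · t = y.
  data Clears (s : Carrier) : Tensor M → Carrierᴹ → Set (c ⊔ ℓ ⊔ m ⊔ ℓm) where
    ⊗-clears : ∀ {x p b} → ι b ≈Q ι s *Q proj₁ p → Clears s (x ⊗ p) (x *ᵣ b)
    0-clears : Clears s 0⊗ 0ᴹ
    +-clears : ∀ {t u x y} → Clears s t x → Clears s u y → Clears s (t +⊗ u) (x +ᴹ y)
    -‿clears : ∀ {t x} → Clears s t x → Clears s (-⊗ t) (-ᴹ x)

  clears-unique : ∀ {s t x y} → Clears s t x → Clears s t y → x ≈ᴹ y
  clears-unique (⊗-clears b≈) (⊗-clears b′≈) = *ᵣ-congˡ (ι-injective (QD.trans b≈ (QD.sym b′≈)))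
  clears-unique 0-clears 0-clears = ≈ᴹ-refl
  clears-unique (+-clears t u) (+-clears t′ u′) = +ᴹ-cong (clears-unique t t′) (clears-unique u u′)
  clears-unique (-‿clears t) (-‿clears t′) = -ᴹ‿cong (clears-unique t t′)

  -- Brings two tensors to a common denominator. The last index of `Clears` is built along the
  -- tensor, so the scaled value is a new element that agrees with y · r only up to `≈ᴹ`.
  clears-scale : ∀ {s s′ t y} r → s′ ≈ s * r → Clears s t y →
                 ∃ λ y′ → Clears s′ t y′ × y′ ≈ᴹ y *ᵣ r
  clears-scale {s} {s′} r s′≈sr (⊗-clears {x} {p} {b} b≈) =
    _ , ⊗-clears (begin
      ι (b * r)                   ≈⟨ ι-* b r ⟩
      ι b *Q ι r                  ≈⟨ QD.*-comm (ι b) (ι r) ⟩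
      ι r *Q ι b                  ≈⟨ QD.*-congˡ {ι r} b≈ ⟩
      ι r *Q (ι s *Q proj₁ p)     ≈⟨ QD.*-assoc (ι r) (ι s) (proj₁ p) ⟨
      (ι r *Q ι s) *Q proj₁ p     ≈⟨ QD.*-congʳ {proj₁ p} (ι-* r s) ⟨
      ι (r * s) *Q proj₁ p        ≈⟨ QD.*-congʳ {proj₁ p} (ι-cong (trans (*-comm r s) (sym s′≈sr))) ⟩
      ι s′ *Q proj₁ p             ∎)
    , ≈ᴹ-sym (*ᵣ-assoc x b r)
    where open SetoidReasoning QD.setoid
  clears-scale r s′≈sr 0-clears = _ , 0-clears , ≈ᴹ-sym (*ᵣ-zeroˡ r)
  clears-scale r s′≈sr (+-clears t u)
    with x , t , x≈ ← clears-scale r s′≈sr t | y , u , y≈ ← clears-scale r s′≈sr u =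
    _ , +-clears t u , ≈ᴹ-trans (+ᴹ-cong x≈ y≈) (≈ᴹ-sym (*ᵣ-distribʳ r _ _))
  clears-scale r s′≈sr (-‿clears {x = x₀} t) with x , t , x≈ ← clears-scale r s′≈sr t =
    _ , -‿clears t , ≈ᴹ-trans (-ᴹ‿cong x≈) (≈ᴹ-trans (≈ᴹ-sym (*ᵣ-neg _))
      (≈ᴹ-trans (*ᵣ-comm x₀ r (- 1#)) (*ᵣ-congʳ (*ᵣ-neg x₀))))

  Cleared : Tensor M → Carrier → Set (c ⊔ ℓ ⊔ m ⊔ ℓm)
  Cleared t s = ∃ λ y → Clears s t y

  cleared-*ˡ : ∀ {t s} r → Cleared t s → Cleared t (r * s)
  cleared-*ˡ {s = s} r (_ , t) with y , t , _ ← clears-scale r (*-comm r s) t = y , t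

  cleared-*ʳ : ∀ {t s} r → Cleared t s → Cleared t (s * r)
  cleared-*ʳ r (_ , t) with y , t , _ ← clears-scale r refl t = y , t

  denominator : ∀ t → ∃ λ s → s ∉ ideal × Cleared t s
  denominator (x ⊗ (q , inLocal a s s∉ q≈)) = s , s∉ , _ , ⊗-clears
    (QD.trans (cross (trans (*-congˡ (*-identityˡ s)) (trans (*-comm a s) (sym (*-identityʳ _)))))
             (QD.*-congˡ {ι s} (QD.sym q≈)))
  denominator 0⊗ = 1# , proper , _ , 0-clears
  denominator (t +⊗ u) with s , s∉ , t ← denominator t | r , r∉ , u ← denominator u
    with _ , t ← cleared-*ʳ r t | _ , u ← cleared-*ˡ s u =
    s * r , *-∉ s∉ r∉ , _ , +-clears t u
  denominator (-⊗ t) with s , s∉ , _ , t ← denominator t = s , s∉ , _ , -‿clears t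

  -- Equality of fractions over the complement of 𝓜: a single s clears both formal sums, to equal
  -- elements of M. It brings relations of M_𝓜 back into M, which the generated congruence `≈⊗` does
  -- not do directly.
  _∼_ : Tensor M → Tensor M → Set (c ⊔ ℓ ⊔ m ⊔ ℓm)
  t ∼ u = ∃ λ s → s ∉ ideal × ∃ λ x → ∃ λ y → Clears s t x × Clears s u y × x ≈ᴹ y

  scale-∼ : ∀ {t u s x y} r {s′} → s′ ≈ s * r → Clears s t x → Clears s u y → x ≈ᴹ y →
            ∃ λ x′ → ∃ λ y′ → Clears s′ t x′ × Clears s′ u y′ × x′ ≈ᴹ y′
  scale-∼ r s′≈ t u x≈y
    with x′ , t , x′≈ ← clears-scale r s′≈ t | y′ , u , y′≈ ← clears-scale r s′≈ u =
    x′ , y′ , t , u , ≈ᴹ-trans x′≈ (≈ᴹ-trans (*ᵣ-congʳ x≈y) (≈ᴹ-sym y′≈))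

  -- Induction on the derivation. Each axiom is checked with a denominator that clears both of its
  -- sides. For transitivity both premises are scaled to s · r, and `clears-unique` identifies the
  -- two values of the middle tensor.
  ≈⊗⇒∼ : ∀ {t u} → _≈⊗_ M t u → t ∼ u
  ≈⊗⇒∼ (refl⊗ {t}) with s , s∉ , x , t ← denominator t = s , s∉ , x , x , t , t , ≈ᴹ-refl
  ≈⊗⇒∼ (sym⊗ e) with s , s∉ , x , y , t , u , x≈y ← ≈⊗⇒∼ e = s , s∉ , y , x , u , t , ≈ᴹ-sym x≈y
  ≈⊗⇒∼ (trans⊗ e f)
    with s , s∉ , _ , _ , t , u , x≈y ← ≈⊗⇒∼ e | r , r∉ , _ , _ , u′ , w , y′≈z ← ≈⊗⇒∼ f
    with x , y , t , u , x≈y ← scale-∼ r refl t u x≈y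
       | y′ , z , u′ , w , y′≈z ← scale-∼ s (*-comm s r) u′ w y′≈z =
    s * r , *-∉ s∉ r∉ , x , z , t , w , ≈ᴹ-trans x≈y (≈ᴹ-trans (clears-unique u u′) y′≈z)
  ≈⊗⇒∼ (+-cong⊗ e f)
    with s , s∉ , _ , _ , t , u , x≈y ← ≈⊗⇒∼ e | r , r∉ , _ , _ , t′ , u′ , x′≈y′ ← ≈⊗⇒∼ f
    with x , y , t , u , x≈y ← scale-∼ r refl t u x≈y
       | x′ , y′ , t′ , u′ , x′≈y′ ← scale-∼ s (*-comm s r) t′ u′ x′≈y′ =
    s * r , *-∉ s∉ r∉ , _ , _ , +-clears t t′ , +-clears u u′ , +ᴹ-cong x≈y x′≈y′
  ≈⊗⇒∼ (-‿cong⊗ e) with s , s∉ , _ , _ , t , u , x≈y ← ≈⊗⇒∼ e =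
    s , s∉ , _ , _ , -‿clears t , -‿clears u , -ᴹ‿cong x≈y
  ≈⊗⇒∼ (⊗-cong {x} {p = p} x≈y (inQ p≈q)) with s , s∉ , _ , ⊗-clears b≈ ← denominator (x ⊗ p) =
    s , s∉ , _ , _ , ⊗-clears b≈ , ⊗-clears (QD.trans b≈ (QD.*-congˡ {ι s} p≈q)) , *ᵣ-congʳ x≈y
  ≈⊗⇒∼ (assoc⊗ t u w) with s , s∉ , _ , +-clears (+-clears t u) w ← denominator ((t +⊗ u) +⊗ w) =
    s , s∉ , _ , _ , +-clears (+-clears t u) w , +-clears t (+-clears u w) , +ᴹ-assoc _ _ _
  ≈⊗⇒∼ (comm⊗ t u) with s , s∉ , _ , +-clears t u ← denominator (t +⊗ u) =
    s , s∉ , _ , _ , +-clears t u , +-clears u t , +ᴹ-comm _ _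
  ≈⊗⇒∼ (identityˡ⊗ t) with s , s∉ , _ , t ← denominator t =
    s , s∉ , _ , _ , +-clears 0-clears t , t , +ᴹ-identityˡ _
  ≈⊗⇒∼ (inverseˡ⊗ t) with s , s∉ , _ , t ← denominator t =
    s , s∉ , _ , _ , +-clears (-‿clears t) t , 0-clears , -ᴹ‿inverseˡ _
  ≈⊗⇒∼ (distribˡ⊗ x p q)
    with s , s∉ , _ , +-clears (⊗-clears {b = a} a≈) (⊗-clears {b = b} b≈) ←
         denominator (x ⊗ p +⊗ x ⊗ q) =
    s , s∉ , _ , _ ,
    ⊗-clears (QD.trans (ι-+ a b) (QD.trans (QD.+-cong a≈ b≈)
      (QD.sym (QD.distribˡ (ι s) (proj₁ p) (proj₁ q))))) ,
    +-clears (⊗-clears a≈) (⊗-clears b≈) , *ᵣ-distribˡ x a b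
  ≈⊗⇒∼ (distribʳ⊗ x y p) with s , s∉ , _ , ⊗-clears {b = b} b≈ ← denominator (x ⊗ p) =
    s , s∉ , _ , _ , ⊗-clears b≈ , +-clears (⊗-clears b≈) (⊗-clears b≈) , *ᵣ-distribʳ b x y
  ≈⊗⇒∼ (balanced x d p) with s , s∉ , _ , ⊗-clears {b = b} b≈ ← denominator (x ⊗ p) =
    s , s∉ , _ , _ , ⊗-clears b≈ ,
    ⊗-clears (QD.trans (ι-* d b) (QD.trans (QD.*-congˡ {ι d} b≈)
      (x∙yz≈y∙xz (ι d) (ι s) (proj₁ p)))) ,
    *ᵣ-assoc x d b

  clears-*⊗ : ∀ {s t y} d → Clears s t y →
              ∃ λ y′ → Clears s (_*⊗_ M t (localize d)) y′ × y′ ≈ᴹ y *ᵣ d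
  clears-*⊗ {s} d (⊗-clears {x} {p} {b} b≈) = _ ,
    ⊗-clears (QD.trans (ι-* b d) (QD.trans (QD.*-congʳ {ι d} b≈)
      (QD.*-assoc (ι s) (proj₁ p) (ι d)))) ,
    ≈ᴹ-sym (*ᵣ-assoc x b d)
  clears-*⊗ d 0-clears = _ , 0-clears , ≈ᴹ-sym (*ᵣ-zeroˡ d)
  clears-*⊗ d (+-clears t u) with x , t , x≈ ← clears-*⊗ d t | y , u , y≈ ← clears-*⊗ d u =
    _ , +-clears t u , ≈ᴹ-trans (+ᴹ-cong x≈ y≈) (≈ᴹ-sym (*ᵣ-distribʳ d _ _))
  clears-*⊗ d (-‿clears {x = x₀} t) with x , t , x≈ ← clears-*⊗ d t =
    _ , -‿clears t , ≈ᴹ-trans (-ᴹ‿cong x≈) (≈ᴹ-trans (≈ᴹ-sym (*ᵣ-neg _))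
      (≈ᴹ-trans (*ᵣ-comm x₀ d (- 1#)) (*ᵣ-congʳ (*ᵣ-neg x₀))))

  _∣⊗_ : Carrier → Tensor M → Set (c ⊔ ℓ ⊔ m ⊔ ℓm)
  d ∣⊗ t = ∃ λ n → _≈⊗_ M (_*⊗_ M n (localize d)) t

  ∣⊗-localize : ∀ {d x} → d ∣ᴹ x → d ∣⊗ localizeᴹ M x
  ∣⊗-localize {d} (z , zd≈x) = z ⊗ L.1# , trans⊗
    (⊗-cong ≈ᴹ-refl (L.*-comm L.1# (localize d)))
    (trans⊗ (sym⊗ (balanced z d L.1#)) (⊗-cong zd≈x L.refl))

  -- Let s clear n to y, and let r clear both sides of n · d ≈ x ⊗ 1. Clearing n · d by s · r gives
  -- y · r · d along the first way and x · r · s along the second, and cleared values are unique.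
  ∣⊗-delocalize : ∀ {d x} → d ∣⊗ localizeᴹ M x → ∃ λ r → r ∉ ideal × d ∣ᴹ (x *ᵣ r)
  ∣⊗-delocalize {d} {x} (n , nd≈x)
    with s , s∉ , y , n↦y ← denominator n
       | r , r∉ , w , _ , nd↦w , ⊗-clears {b = b} b≈ , w≈xb ← ≈⊗⇒∼ nd≈x
    with y′ , nd↦y′ , y′≈yd ← clears-*⊗ d n↦y
    with y″ , nd↦y″ , y″≈y′r ← clears-scale r refl nd↦y′
       | w′ , nd↦w′ , w′≈ws ← clears-scale s (*-comm s r) nd↦w =
    r * s , *-∉ r∉ s∉ , y *ᵣ r , (begin
      y *ᵣ r *ᵣ d    ≈⟨ *ᵣ-comm y r d ⟩
      y *ᵣ d *ᵣ r    ≈⟨ *ᵣ-congʳ y′≈yd ⟨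
      y′ *ᵣ r        ≈⟨ y″≈y′r ⟨
      y″             ≈⟨ clears-unique nd↦y″ nd↦w′ ⟩
      w′             ≈⟨ w′≈ws ⟩
      w *ᵣ s         ≈⟨ *ᵣ-congʳ w≈xb ⟩
      -- Here b is what r makes of x ⊗ 1, so b = r · 1.
      x *ᵣ b *ᵣ s    ≈⟨ *ᵣ-congʳ (*ᵣ-congˡ (ι-injective (QD.trans b≈ (QD.*-identityʳ (ι r))))) ⟩
      x *ᵣ r *ᵣ s    ≈⟨ *ᵣ-assoc x r s ⟩
      x *ᵣ (r * s)   ∎)
    where open SetoidReasoning ≈ᴹ-setoid

-- Divisions in the localization

-- (d , t) is the formula ∃ z. z · d ≐ t, that is V_{v(d)}(t), or t ≐ 0 if d ≈ 0.
Division : ∀ {s x} → Set s → Set x → Set (s ⊔ x)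
Division S X = S × Term S X

module LocalDivision (em : ∀ {a} → ExcludedMiddle a) {c ℓ m ℓm} (D : IntegralDomain c ℓ)
                     (M : Module (IntegralDomain.commutativeRing D) m ℓm) where
  open IntegralDomain D
  open Divisibility D using (v)
  open FractionField D using (ι; cross; ≈0; num≈0)
  open LocalFormulas D
  open Localization D
  open Module M
  open Semantics D using (eval)
  open Spectrum D

  localScalar : ∀ C → Carrier → LocalScalar C
  localScalar C a = ι a , λ 𝓜 _ → proj₂ (localize 𝓜 a)

  localize-≉0 : ∀ 𝓜 {d} → ¬ d ≈ 0# → ¬ _≈L_ 𝓜 (localize 𝓜 d) (0L 𝓜)
  localize-≉0 𝓜 d≉0 (inQ d≈0) = d≉0 (num≈0 d≈0)

  localize-v : ∀ 𝓜 {d} (d≉0 : ¬ d ≈ 0#) →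
               Divisibility._≈Γ_ (localDomain 𝓜) (localizeΓ 𝓜 (v (d , d≉0)))
                 (Divisibility.v (localDomain 𝓜) (localize 𝓜 d , localize-≉0 𝓜 d≉0))
  localize-v 𝓜 {d} d≉0 = L.1# , (L.1# , L.*-identityˡ L.1#) , FractionField.cross
    (L.trans (L.*-congˡ {localize 𝓜 d} (L.*-identityˡ L.1#))
             (L.*-congʳ {L.1#} (L.sym (L.*-identityˡ (localize 𝓜 d)))))
    where module L = IntegralDomain (localDomain 𝓜)

  localValue : ∀ C {d} → ¬ d ≈ 0# → LocalValue C
  localValue C d≉0 = v (_ , d≉0) ,
    λ 𝓜 _ → (localize 𝓜 _ , localize-≉0 𝓜 d≉0) , localize-v 𝓜 d≉0

  module _ {n : ℕ} (C : Constructible) where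

    private
      -- The value v(d) exists only for d ≉ 0; otherwise the division says t = 0. The decision is an
      -- argument, so that satisfaction can be proved by matching on it.
      local′ : ((d , t) : Division Carrier (Fin n)) → Dec (d ≈ 0#) →
               Atomic (LocalScalar C) (LocalValue C) (Fin n)
      local′ (d , t) (yes _)  = mapTerm (localScalar C) t ≐ 0ᵗ
      local′ (d , t) (no d≉0) = V (localValue C d≉0) (mapTerm (localScalar C) t)

    localAtom : Division Carrier (Fin n) → Atomic (LocalScalar C) (LocalValue C) (Fin n)
    localAtom δ = local′ δ em

    module _ (𝓜 : MSpec) (𝓜∈C : 𝓜 ∈ ⟦ C ⟧) (u : Fin n → Carrierᴹ) where
      open Denominators D 𝓜 M
      open Semantics (localDomain 𝓜) renaming (eval to evalL) using (⟦_⟧ₐ; canonicalV)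
      private
        M𝓜 = tensorModule 𝓜 M
        module L = IntegralDomain (localDomain 𝓜)
        module N = Module M𝓜

        scalar : LocalScalar C → Local 𝓜
        scalar (q , q∈) = q , q∈ 𝓜 𝓜∈C

        value : LocalValue C → Divisibility.Γ⁺ (localDomain 𝓜)
        value (δ , δ∈) = localizeΓ 𝓜 δ , δ∈ 𝓜 𝓜∈C

      -- Writing `0ᴹ` as a multiple by zero lets `balanced` move the zero to the scalar side of the
      -- tensor.
      localize-0 : localizeᴹ 𝓜 M 0ᴹ N.≈ᴹ N.0ᴹ
      localize-0 = trans⊗ (⊗-cong (≈ᴹ-sym (*ᵣ-zeroʳ 0ᴹ)) L.refl) (trans⊗ (balanced 0ᴹ 0# L.1#)
        (trans⊗ (⊗-cong ≈ᴹ-refl (L.*-comm L.0# L.1#)) (N.*ᵣ-zeroʳ (0ᴹ ⊗ L.1#))))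

      eval-localize : ∀ t → evalL M𝓜 (localizeᴹ 𝓜 M ∘ u) (mapTerm scalar (mapTerm (localScalar C) t))
                            N.≈ᴹ localizeᴹ 𝓜 M (eval M u t)
      eval-localize (var x)  = refl⊗
      eval-localize 0ᵗ       = sym⊗ localize-0
      eval-localize (t +ᵗ w) = trans⊗ (+-cong⊗ (eval-localize t) (eval-localize w))
        (sym⊗ (distribʳ⊗ _ _ _))
      eval-localize (-ᵗ t)   = trans⊗ (-‿cong⊗ (eval-localize t)) (sym⊗ (N.uniqueʳ‿-ᴹ _ _
        (trans⊗ (sym⊗ (distribʳ⊗ _ _ _)) (trans⊗ (⊗-cong (-ᴹ‿inverseʳ _) L.refl) localize-0))))
      eval-localize (t ·ᵗ a) = trans⊗ (N.*ᵣ-congʳ (eval-localize t))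
        (trans⊗ (⊗-cong ≈ᴹ-refl (L.*-comm L.1# (localize 𝓜 a))) (sym⊗ (balanced _ a L.1#)))

      private
        local′-sat : ∀ δ dec →
                     ⟦_⟧ₐ M𝓜 (canonicalV M𝓜) (mapAtomic scalar value (local′ δ dec)) (localizeᴹ 𝓜 M ∘ u)
                     ⇔ proj₁ δ ∣⊗ localizeᴹ 𝓜 M (eval M u (proj₂ δ))
        local′-sat (d , t) (yes d≈0) = mk⇔
          (λ (lift t≈0) → 0⊗ , sym⊗ (trans⊗ (sym⊗ (eval-localize t)) t≈0))
          (λ (n , nd≈t) → lift (trans⊗ (eval-localize t) (trans⊗ (sym⊗ nd≈t)
            (trans⊗ (N.*ᵣ-congˡ {n} (inQ (≈0 d≈0))) (N.*ᵣ-zeroʳ n)))))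
        local′-sat (d , t) (no d≉0) = mk⇔
          (λ (lift ((a , _) , (w , (w⁻¹ , ww⁻¹≈1) , FractionField.cross d1≈wa1) , n , na≈t)) →
            -- `canonicalV` supplies some a with the value of d, hence d = w · a for a unit w; the
            -- quotient by a is corrected by w⁻¹.
            n N.*ᵣ w⁻¹ , (begin
              n N.*ᵣ w⁻¹ N.*ᵣ localize 𝓜 d   ≈⟨ N.*ᵣ-assoc n w⁻¹ (localize 𝓜 d) ⟩
              n N.*ᵣ (w⁻¹ L.* localize 𝓜 d)  ≈⟨ N.*ᵣ-congˡ {n} (w⁻¹d≈a d1≈wa1 ww⁻¹≈1) ⟩
              n N.*ᵣ a                        ≈⟨ trans⊗ na≈t (eval-localize t) ⟩
              localizeᴹ 𝓜 M (eval M u t)     ∎))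
          (λ (n , nd≈t) → lift ((localize 𝓜 d , localize-≉0 𝓜 d≉0) , localize-v 𝓜 d≉0 ,
            n , trans⊗ nd≈t (sym⊗ (eval-localize t))))
          where
          open SetoidReasoning N.≈ᴹ-setoid
          w⁻¹d≈a : ∀ {w w⁻¹ a} → localize 𝓜 d L.* (L.1# L.* L.1#) L.≈ (w L.* a) L.* L.1# →
                   w L.* w⁻¹ L.≈ L.1# → w⁻¹ L.* localize 𝓜 d L.≈ a
          w⁻¹d≈a {w} {w⁻¹} {a} d1≈wa1 ww⁻¹≈1 =
            L.trans (L.*-congˡ {w⁻¹} (L.trans (L.sym (L.trans (L.*-congˡ {localize 𝓜 d} (L.*-identityˡ L.1#))
                                                              (L.*-identityʳ (localize 𝓜 d))))
                                              (L.trans d1≈wa1 (L.*-identityʳ (w L.* a)))))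
            (L.trans (x∙yz≈yx∙z w⁻¹ w a) (L.trans (L.*-congʳ {a} ww⁻¹≈1) (L.*-identityˡ a)))
            where open CommutativeSemigroupProperties L.*-commutativeSemigroup using (x∙yz≈yx∙z)

      localAtom-sat : ∀ δ →
                      ⟦_⟧ₐ M𝓜 (canonicalV M𝓜) (mapAtomic scalar value (localAtom δ)) (localizeᴹ 𝓜 M ∘ u)
                      ⇔ proj₁ δ ∣⊗ localizeᴹ 𝓜 M (eval M u (proj₂ δ))
      localAtom-sat δ = local′-sat δ em

      map-localAtom-sat : ∀ δs → LocalSat M C (map localAtom δs) 𝓜 𝓜∈C u ⇔
                  All (λ (d , t) → d ∣⊗ localizeᴹ 𝓜 M (eval M u t)) δs
      map-localAtom-sat δs = mk⇔
        (λ sat → All.map (λ {δ} → Equivalence.to (localAtom-sat δ)) (All.map⁻ (All.map⁻ sat)))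
        (λ divides → All.map⁺ (All.map⁺ (All.map (λ {δ} → Equivalence.from (localAtom-sat δ)) divides)))

-- Elimination

module Elimination (em : ∀ {a} → ExcludedMiddle a) {c ℓ m ℓm} (B : BezoutDomain c ℓ)
                   (M : Module (BezoutDomain.commutativeRing B) m ℓm) where
  open BezoutDomain B hiding (zero)
  open Spectrum integralDomain
  open MSpec using (ideal; proper; *-∉)
  open Cofactors em B
  open Module M
  open LinearSystems M
  open Semantics integralDomain using (eval)

  -- The scalar s stands for the open set s ∉ 𝓜, the list for the divisions that replace the system
  -- there.
  Branch : ℕ → Set c
  Branch n = Carrier × List (Division Carrier (Fin n))

  -- The two directions differ. A solution in M yields the divisions in M itself, wherever s lies;
  -- the converse is claimed only where s ∉ 𝓜. Local divisibility and solvability are stated inside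
  -- M, up to a scalar r ∉ 𝓜 that may vary with the division.
  Sound : ∀ {e m n} → (Fin e → Vector Carrier m) → (Fin e → Term Carrier (Fin n)) →
          Pred (Branch n) _
  Sound a t (s , ψ) = ∀ u →
    (Solvable a (eval M u ∘ t) → All (λ (d , t) → d ∣ᴹ eval M u t) ψ) ×
    (∀ 𝓜 → s ∉ ideal 𝓜 →
      All (λ (d , t) → ∃ λ r → r ∉ ideal 𝓜 × d ∣ᴹ (eval M u t *ᵣ r)) ψ →
      ∃ λ r → r ∉ ideal 𝓜 × Solvable a (λ k → eval M u (t k) *ᵣ r))

  Elimination : ∀ {e m n} → (Fin e → Vector Carrier m) → (Fin e → Term Carrier (Fin n)) → Set _
  Elimination {n = n} a t = Σ (List (Branch n)) λ bs →
    (∀ 𝓜 → Any (λ (s , _) → s ∉ ideal 𝓜) bs) × All (Sound a t) bs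

  -- The product of finitely many scalars outside 𝓜 stays outside, since maximal ideals are prime.
  common-annihilator : ∀ 𝓜 {e} (x : Fin e → Carrierᴹ) →
                       (∀ k → ∃ λ r → r ∉ ideal 𝓜 × x k *ᵣ r ≈ᴹ 0ᴹ) →
                       ∃ λ r → r ∉ ideal 𝓜 × (∀ k → x k *ᵣ r ≈ᴹ 0ᴹ)
  common-annihilator 𝓜 {zero}  x ann = 1# , proper 𝓜 , λ ()
  common-annihilator 𝓜 {suc e} x ann
    with r , r∉ , x₀r≈0 ← ann zero | s , s∉ , xs≈0 ← common-annihilator 𝓜 (x ∘ suc) (ann ∘ suc) =
    r * s , *-∉ 𝓜 r∉ s∉ , λ
      { zero    → ≈ᴹ-trans (≈ᴹ-sym (*ᵣ-assoc _ r s)) (≈ᴹ-trans (*ᵣ-congʳ x₀r≈0) (*ᵣ-zeroˡ s))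
      ; (suc k) → ≈ᴹ-trans (*ᵣ-congˡ (*-comm r s)) (≈ᴹ-trans (≈ᴹ-sym (*ᵣ-assoc _ s r))
                    (≈ᴹ-trans (*ᵣ-congʳ (xs≈0 k)) (*ᵣ-zeroˡ r)))
      }

  -- A zero matrix is solvable only for vanishing constants, that is, constants divisible by 0. The
  -- single branch s = 1 covers the whole spectrum.
  eliminate-zero : ∀ {e m n} (a : Fin e → Vector Carrier m) (t : Fin e → Term Carrier (Fin n)) →
                   (∀ k l → a k l ≈ 0#) → Elimination a t
  eliminate-zero a t a≈0 = (1# , tabulate λ k → 0# , t k) ∷ [] , (λ 𝓜 → here (proper 𝓜)) ,
    (λ u →
      (λ (x , ax≈t) → All.tabulate⁺ λ k → 0ᴹ ,
        ≈ᴹ-trans (*ᵣ-zeroʳ 0ᴹ) (≈ᴹ-trans (≈ᴹ-sym (dot-0ˡ x (a≈0 k))) (ax≈t k))) ,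
      (λ 𝓜 _ divides →
        let r , r∉ , tr≈0 = common-annihilator 𝓜 (eval M u ∘ t) λ k →
              let r , r∉ , z , z0≈tr = All.tabulate⁻ divides k in
              r , r∉ , ≈ᴹ-trans (≈ᴹ-sym z0≈tr) (*ᵣ-zeroʳ z)
        in r , r∉ , (λ _ → 0ᴹ) , λ k → ≈ᴹ-trans (dot-0ˡ (λ _ → 0ᴹ) (a≈0 k)) (≈ᴹ-sym (tr≈0 k)))) ∷ []

  elimination : ∀ {e m n} (a : Fin e → Vector Carrier m) (t : Fin e → Term Carrier (Fin n)) →
                Elimination a t
  -- Without unknowns the matrix is vacuously zero.
  elimination {m = zero} a t = eliminate-zero a t λ _ ()
  elimination {e} {suc m} {n} a t = [ all-zero , some-pivot ]′ (zero-or-cofactors entry)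
    where
    position : Fin (e ℕ.* suc m) → Fin e × Fin (suc m)
    position = remQuot (suc m)

    -- The matrix is flattened so that one gcd is taken over all its entries.
    entry : Vector Carrier (e ℕ.* suc m)
    entry p = uncurry a (position p)

    entry-combine : ∀ k l → entry (combine k l) ≈ a k l
    entry-combine k l = reflexive (≡.cong (uncurry a) (remQuot-combine k l))

    all-zero : (∀ p → entry p ≈ 0#) → Elimination a t
    all-zero entry≈0 = eliminate-zero a t λ k l →
      trans (sym (entry-combine k l)) (entry≈0 (combine k l))

    some-pivot : Cofactors entry → Elimination a t
    some-pivot (h , swap , h∉) =
      -- Every entry p is tried as a pivot. Since 𝓜 is prime, h p · s ∉ 𝓜 holds exactly when h p ∉ 𝓜
      -- and 𝓜 lies in the branch s of the smaller system.
      concat (tabulate λ p → map (extend p) (proj₁ (recurse p))) ,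
      (λ 𝓜 → let p , hp∉ = h∉ 𝓜 in Any.concat⁺ (Any.tabulate⁺ p (Any.map⁺
        (Any.map (*-∉ 𝓜 hp∉) (proj₁ (proj₂ (recurse p)) 𝓜))))) ,
      All.concat⁺ (All.tabulate⁺ λ p → All.map⁺
        (All.map (λ {b} → extend-sound p b) (proj₂ (proj₂ (recurse p)))))
      where
      module _ (p : Fin (e ℕ.* suc m)) where
        i : Fin e
        i = proj₁ (position p)

        j : Fin (suc m)
        j = proj₂ (position p)

        g : Fin e → Carrier
        -- The cofactor of the entry of row k in the pivot column.
        g k = h (combine k j)

        a′ : Fin e → Vector Carrier m
        a′ = eliminate a i j (h p) g

        t′ : Fin e → Term Carrier (Fin n)
        t′ k = (t k ·ᵗ h p) +ᵗ (t i ·ᵗ (- g k))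

        recurse : Elimination a′ t′
        recurse = elimination a′ t′

        extend : Branch n → Branch n
        extend (s , ψ) = h p * s , (a i j , t i ·ᵗ h p) ∷ ψ

        column : ∀ k → a k j * h p ≈ a i j * g k
        column k = trans (*-congʳ (sym (entry-combine k j))) (swap p (combine k j))

        row : ∀ l → a i l * h p ≈ h (combine i l) * a i j
        row l = trans (*-congʳ (sym (entry-combine i l)))
                      (trans (swap p (combine i l)) (*-comm _ _))

        extend-sound : ∀ b → Sound a′ t′ b → Sound a t (extend b)
        extend-sound (s , ψ) sound u =
          (λ solvable →
            let divides , solvable′ = eliminate-solvable solvable
            in divides ∷ proj₁ (sound u) solvable′) ,
          (λ { 𝓜 hps∉ ((r′ , r′∉ , divides) ∷ ψ-divides) →
            let hp∉ = λ hp∈ → hps∉ (MSpec.resp 𝓜 (*-comm s (h p)) (MSpec.*-closed 𝓜 s hp∈))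
                s∉  = λ s∈ → hps∉ (MSpec.*-closed 𝓜 (h p) s∈)
                r , r∉ , solvable′ = proj₂ (sound u) 𝓜 s∉ ψ-divides
            in h p * (r * (h p * r′)) , *-∉ 𝓜 hp∉ (*-∉ 𝓜 r∉ (*-∉ 𝓜 hp∉ r′∉)) ,
               solvable-eliminate solvable′ divides })
          where
          open Pivot a i j (h p) g (λ l → h (combine i l)) column row (eval M u ∘ t)

-- Positive primitive formulas as linear systems

module Linearization {c ℓ m ℓm} (D : IntegralDomain c ℓ)
                     (M : Module (IntegralDomain.commutativeRing D) m ℓm) where
  open IntegralDomain D hiding (zero)
  open Module M
  open LinearSystems M
  open Semantics D using (eval)
  open CommutativeSemigroupProperties (CommutativeMonoid.commutativeSemigroup +ᴹ-commutativeMonoid)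
    using () renaming (interchange to +ᴹ-interchange)

  module _ {b n : ℕ} where

    coefficients : Term Carrier (Fin b ⊎ Fin n) → Vector Carrier b
    coefficients (var (inj₁ x)) = unit x
    coefficients (var (inj₂ y)) = λ _ → 0#
    coefficients 0ᵗ             = λ _ → 0#
    coefficients (t +ᵗ t′)      = λ l → coefficients t l + coefficients t′ l
    coefficients (-ᵗ t)         = λ l → coefficients t l * - 1#
    coefficients (t ·ᵗ a)       = λ l → coefficients t l * a

    parameters : Term Carrier (Fin b ⊎ Fin n) → Term Carrier (Fin n)
    parameters (var (inj₁ x)) = 0ᵗ
    parameters (var (inj₂ y)) = var y
    parameters 0ᵗ             = 0ᵗ
    parameters (t +ᵗ t′)      = parameters t +ᵗ parameters t′
    parameters (-ᵗ t)         = -ᵗ parameters t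
    parameters (t ·ᵗ a)       = parameters t ·ᵗ a

    eval-split : ∀ (w : Vector Carrierᴹ b) (u : Vector Carrierᴹ n) t →
                 eval M [ w , u ]′ t ≈ᴹ dot (coefficients t) w +ᴹ eval M u (parameters t)
    eval-split w u (var (inj₁ x)) = ≈ᴹ-sym (≈ᴹ-trans (+ᴹ-identityʳ _) (dot-unit x w))
    eval-split w u (var (inj₂ y)) =
      ≈ᴹ-sym (≈ᴹ-trans (+ᴹ-congʳ (dot-0ˡ w λ _ → refl)) (+ᴹ-identityˡ _))
    eval-split w u 0ᵗ =
      ≈ᴹ-sym (≈ᴹ-trans (+ᴹ-identityʳ _) (dot-0ˡ w λ _ → refl))
    eval-split w u (t +ᵗ t′) =
      ≈ᴹ-trans (+ᴹ-cong (eval-split w u t) (eval-split w u t′))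
      (≈ᴹ-trans (+ᴹ-interchange _ _ _ _)
                (+ᴹ-congʳ (≈ᴹ-sym (dot-+ˡ (coefficients t) (coefficients t′) w))))
    eval-split w u (-ᵗ t) =
      ≈ᴹ-trans (-ᴹ‿cong (eval-split w u t)) (≈ᴹ-trans (≈ᴹ-sym (*ᵣ-neg _))
      (≈ᴹ-trans (*ᵣ-distribʳ (- 1#) _ _)
                (+ᴹ-cong (≈ᴹ-sym (dot-*ˡ (coefficients t) w (- 1#))) (*ᵣ-neg _))))
    eval-split w u (t ·ᵗ a) =
      ≈ᴹ-trans (*ᵣ-congʳ (eval-split w u t)) (≈ᴹ-trans (*ᵣ-distribʳ a _ _)
                (+ᴹ-congʳ (≈ᴹ-sym (dot-*ˡ (coefficients t) w a))))

  -- The leading zeros stand at the quotients of the later divisions, which do not occur in the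
  -- given row.
  pad : ∀ k {b} → Vector Carrier b → Vector Carrier (k ℕ.+ b)
  pad zero    a = a
  pad (suc k) a = 0# Vector.∷ pad k a

  dot-0∷ : ∀ {n} (a : Vector Carrier n) (x : Vector Carrierᴹ (suc n)) →
           dot (0# Vector.∷ a) x ≈ᴹ dot a (x ∘ suc)
  dot-0∷ a x = ≈ᴹ-trans (+ᴹ-congʳ (*ᵣ-zeroʳ (x zero))) (+ᴹ-identityˡ _)

  dot-pad : ∀ k {b} (a : Vector Carrier b) x → dot (pad k a) x ≈ᴹ dot a (drop k x)
  dot-pad zero    a x = ≈ᴹ-refl
  dot-pad (suc k) a x = ≈ᴹ-trans (dot-0∷ (pad k a) x) (dot-pad k a (x ∘ suc))

  module _ {b n : ℕ} where

    -- The unknowns are the quotients z of the divisions z · d ≐ t, followed by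
    -- the b bound variables.
    rows : (δs : List (Division Carrier (Fin b ⊎ Fin n))) →
           Fin (length δs) → Vector Carrier (length δs ℕ.+ b)
    rows ((d , t) ∷ δs) zero    = d Vector.∷ pad (length δs) (λ l → coefficients t l * - 1#)
    rows (_       ∷ δs) (suc k) = 0# Vector.∷ rows δs k

    constants : (δs : List (Division Carrier (Fin b ⊎ Fin n))) →
                Fin (length δs) → Term Carrier (Fin n)
    constants δs k = parameters (proj₂ (lookup δs k))

    module _ (u : Vector Carrierᴹ n) where

      private
        Divides : Vector Carrierᴹ b → Pred (Division Carrier (Fin b ⊎ Fin n)) _
        Divides w (d , t) = d ∣ᴹ eval M [ w , u ]′ t

        dot-first : ∀ d t δs x → dot (rows ((d , t) ∷ δs) zero) x ≈ᴹ
                    x zero *ᵣ d +ᴹ -ᴹ dot (coefficients t) (drop (suc (length δs)) x)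
        dot-first d t δs x = +ᴹ-congˡ (≈ᴹ-trans
          (dot-pad (length δs) (λ l → coefficients t l * - 1#) (x ∘ suc))
          (≈ᴹ-trans (dot-*ˡ (coefficients t) (drop (suc (length δs)) x) (- 1#)) (*ᵣ-neg _)))

        -- Moves the bound variables to the left: z · d = t becomes an equation with all unknowns on
        -- one side and the parameters on the other.
        transpose : ∀ {x y z} → x ≈ᴹ y +ᴹ z ⇔ x +ᴹ -ᴹ y ≈ᴹ z
        transpose {x} {y} {z} = mk⇔
          (λ x≈y+z → ≈ᴹ-trans (+ᴹ-congʳ x≈y+z) (xyx⁻¹≈y y z))
          (λ x-y≈z → ≈ᴹ-trans (≈ᴹ-sym (xyx⁻¹≈y y x)) (≈ᴹ-trans (+ᴹ-assoc y x (-ᴹ y)) (+ᴹ-congˡ x-y≈z)))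
          where open AbelianGroupProperties +ᴹ-abelianGroup using (xyx⁻¹≈y)

      -- The induction also records that the solution ends in w, because each new row has to be
      -- evaluated at the same bound variables.
      divides⇒solvable : ∀ w δs → All (Divides w) δs →
        Σ (Solvable (rows δs) (eval M u ∘ constants δs)) λ (x , _) →
          ∀ l → drop (length δs) x l ≈ᴹ w l
      divides⇒solvable w [] [] = (w , λ ()) , λ _ → ≈ᴹ-refl
      divides⇒solvable w ((d , t) ∷ δs) ((z , zd≈t) ∷ divides)
        with (x , solves) , x≈w ← divides⇒solvable w δs divides =
        ((z Vector.∷ x) , λ
          { zero → ≈ᴹ-trans (dot-first d t δs (z Vector.∷ x))
              (Equivalence.to transpose (≈ᴹ-trans zd≈t (≈ᴹ-trans (eval-split w u t)
                (+ᴹ-congʳ (dot-congʳ (coefficients t) λ l → ≈ᴹ-sym (x≈w l))))))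
          ; (suc k) → ≈ᴹ-trans (dot-0∷ (rows δs k) (z Vector.∷ x)) (solves k)
          }) , x≈w

      solvable⇒divides : ∀ δs → ((x , _) : Solvable (rows δs) (eval M u ∘ constants δs)) →
                         All (Divides (drop (length δs) x)) δs
      solvable⇒divides [] _ = []
      solvable⇒divides ((d , t) ∷ δs) (x , solves) =
        (x zero , ≈ᴹ-trans
          (Equivalence.from transpose (≈ᴹ-trans (≈ᴹ-sym (dot-first d t δs x)) (solves zero)))
          (≈ᴹ-sym (eval-split (drop (suc (length δs)) x) u t)))
        ∷ solvable⇒divides δs (x ∘ suc , λ k →
            ≈ᴹ-trans (≈ᴹ-sym (dot-0∷ (rows δs k) x)) (solves (suc k)))

-- Formulas in models as divisibility conditions

module Models {c ℓ m ℓm p} (D : IntegralDomain c ℓ) (M_V : Semantics.TVdivModel D m ℓm p) where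
  open IntegralDomain D hiding (zero)
  open Semantics D
  open TVdivModel M_V hiding (_⊨_[_])
  open TVdivModel using (_⊨_[_])
  open Divisibility D
  open FractionField D
  open LinearSystems module′ using (_∣ᴹ_; Solvable)
  open Linearization D module′

  -- An equation becomes divisibility of the difference by 0.
  division : ∀ {x} {X : Set x} → Atomic Carrier Γ⁺ X → Division Carrier X
  division (t ≐ t′)              = 0# , t +ᵗ (-ᵗ t′)
  division (V (_ , (a , _) , _) t) = a , t

  -- Forwards this is the divisibility axiom at v(a) = δ. Backwards, every z satisfies V_1, so z · a
  -- satisfies V at 1 · v(a), which is δ up to a unit.
  V⇔∣ : ∀ (δ⁺@(_ , (a , _) , _) : Γ⁺) {x} → ⟦V⟧ δ⁺ x ⇔ a ∣ᴹ x
  V⇔∣ δ⁺@(δ , a@(a₀ , _) , δ≈a@(w , (w⁻¹ , ww⁻¹≈1) , δ≈wa)) {x} = mk⇔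
    (λ Vx → V-div a (V-resp {μ = v⁺ a} δ≈a ≈ᴹ-refl Vx))
    (λ (z , za≈x) → V-resp {v⁺ (1# , 1≉0) ·⁺ v⁺ a} {δ⁺} a≈δ za≈x
      (V-· {v⁺ (1# , 1≉0)} a (V-1 z)))
    where
    module QD = IntegralDomain fractionField
    open SetoidReasoning QD.setoid
    a≈δ : v (1# , 1≉0) ·Γ v a ≈Γ δ
    -- From δ = w · a one gets 1 · a = w⁻¹ · δ.
    a≈δ = w⁻¹ , (w , trans (*-comm w⁻¹ w) ww⁻¹≈1) , (begin
      ι 1# *Q ι a₀              ≈⟨ QD.*-congʳ {ι a₀} {ι 1#} {ι (w⁻¹ * w)}
                                     (cross (*-congʳ (trans (sym ww⁻¹≈1) (*-comm w w⁻¹)))) ⟩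
      ι (w⁻¹ * w) *Q ι a₀       ≈⟨ cross {q = (ι w⁻¹ *Q ι w) *Q ι a₀} (*-congˡ (*-congʳ (*-identityˡ 1#))) ⟩
      (ι w⁻¹ *Q ι w) *Q ι a₀    ≈⟨ QD.*-assoc (ι w⁻¹) (ι w) (ι a₀) ⟩
      ι w⁻¹ *Q (ι w *Q ι a₀)    ≈⟨ QD.*-congˡ {ι w⁻¹} δ≈wa ⟨
      ι w⁻¹ *Q proj₁ δ          ∎)

  division-sat : ∀ {x} {X : Set x} (ρ : X → Carrierᴹ) α →
                 ⟦_⟧ₐ module′ ⟦V⟧ α ρ ⇔ proj₁ (division α) ∣ᴹ eval module′ ρ (proj₂ (division α))
  division-sat ρ (t ≐ t′) = mk⇔
    (λ (lift t≈t′) → 0ᴹ , ≈ᴹ-trans (*ᵣ-zeroʳ 0ᴹ) (≈ᴹ-sym (x≈y⇒x∙y⁻¹≈ε t≈t′)))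
    (λ (z , z0≈t-t′) → lift (x∙y⁻¹≈ε⇒x≈y _ _ (≈ᴹ-trans (≈ᴹ-sym z0≈t-t′) (*ᵣ-zeroʳ z))))
    where open GroupProperties +ᴹ-group using (x≈y⇒x∙y⁻¹≈ε; x∙y⁻¹≈ε⇒x≈y)
  division-sat ρ (V δ t) = mk⇔ (λ (lift Vt) → Equivalence.to (V⇔∣ δ) Vt)
                               (λ divides → lift (Equivalence.from (V⇔∣ δ) divides))

  module _ {n} (φ : PPFormula Carrier Γ⁺ n) where
    open PPFormula φ

    divisions : List (Division Carrier (Fin bound ⊎ Fin n))
    divisions = map division matrix

    matrix-sat : ∀ u → M_V ⊨ φ [ u ] ⇔ Solvable (rows divisions) (eval module′ u ∘ constants divisions)
    matrix-sat u = mk⇔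
      (λ (w , sat) → proj₁ (divides⇒solvable u w divisions
        (All.map⁺ (All.map (λ {α} → Equivalence.to (division-sat [ w , u ]′ α)) sat))))
      (λ solvable → _ , All.map (λ {α} → Equivalence.from (division-sat [ _ , u ]′ α))
        (All.map⁻ (solvable⇒divides u divisions solvable)))

-- The covering and the passage between global and local satisfaction

theorem5p6 : (∀ {a} → ExcludedMiddle a) →
    (∀ {a ℓ₁ ℓ₂ p} → Zorn a ℓ₁ ℓ₂ p) →
    ∀ {c ℓ m ℓm p} (B : BezoutDomain c ℓ) →
    let D = BezoutDomain.integralDomain B in
    (M_V : Semantics.TVdivModel D m ℓm p) →
    let M = Semantics.TVdivModel.module′ M_V in
    ∀ {n} (φ : PPFormula (IntegralDomain.Carrier D) (Divisibility.Γ⁺ D) n) →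
    Σ ℕ λ K →
    Σ (Fin K → Spectrum.Constructible D) λ C →
    Σ (∀ k → LocalFormulas.LocalConjunction D (C k) n) λ ψ →
    (∀ 𝓜 → ∃ λ k → 𝓜 ∈ Spectrum.⟦_⟧ D (C k)) ×
    (∀ (u : Fin n → Semantics.TVdivModel.Carrierᴹ M_V) →
    Semantics.TVdivModel._⊨_[_] M_V φ u ⇔
    (∀ k 𝓜 (𝓜∈C : 𝓜 ∈ Spectrum.⟦_⟧ D (C k)) →
    LocalFormulas.LocalSat D M (C k) (ψ k) 𝓜 𝓜∈C u))
theorem5p6 em zorn B M_V {n} φ = length bs , C , ψ , covering ,
  λ u → mk⇔ (to u) (from u ∘ solvable-1 u)
  where
  D = BezoutDomain.integralDomain B
  open BezoutDomain B hiding (zero)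
  open Semantics.TVdivModel M_V hiding (_⊨_[_])
  open Semantics.TVdivModel using (_⊨_[_])
  open Semantics D using (eval)
  open Spectrum D
  open LocalFormulas D
  open LinearSystems module′
  open Linearization D module′
  open Models D M_V
  open Elimination em B module′
  open LocalDivision em D module′
  open MaximalIdeals em zorn D using (local-global)
  open Denominators using (∣⊗-localize; ∣⊗-delocalize)

  A : Fin (length (divisions φ)) → Vector Carrier (length (divisions φ) ℕ.+ PPFormula.bound φ)
  A = rows (divisions φ)

  t : Fin (length (divisions φ)) → Term Carrier (Fin n)
  t = constants (divisions φ)

  bs : List (Branch n)
  bs = proj₁ (elimination A t)

  covers : ∀ 𝓜 → Any (λ (s , _) → s ∉ MSpec.ideal 𝓜) bs
  covers = proj₁ (proj₂ (elimination A t))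

  sound : ∀ k → Sound A t (lookup bs k)
  sound k = All.lookup (proj₂ (proj₂ (elimination A t))) (∈-lookup k)

  C : Fin (length bs) → Constructible
  C k = ∁ᶜ V[ proj₁ (lookup bs k) ]

  ψ : ∀ k → LocalConjunction (C k) n
  ψ k = map (localAtom (C k)) (proj₂ (lookup bs k))

  covering : ∀ 𝓜 → ∃ λ k → 𝓜 ∈ ⟦ C k ⟧
  covering 𝓜 = Any.index (covers 𝓜) , Any.lookup-index (covers 𝓜)

  LocallySat : (Fin n → Carrierᴹ) → Set _
  LocallySat u = ∀ k 𝓜 (𝓜∈C : 𝓜 ∈ ⟦ C k ⟧) → LocalSat module′ (C k) (ψ k) 𝓜 𝓜∈C u

  -- Soundness gives the divisions over M itself, and x ↦ x ⊗ 1 carries them into every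
  -- localization.
  to : ∀ u → M_V ⊨ φ [ u ] → LocallySat u
  to u sat k 𝓜 𝓜∈C = Equivalence.from (map-localAtom-sat (C k) 𝓜 𝓜∈C u (proj₂ (lookup bs k)))
    (All.map (∣⊗-localize D 𝓜 module′)
      (proj₁ (sound k u) (Equivalence.to (matrix-sat φ u) sat)))

  Scaled : (Fin n → Carrierᴹ) → Pred Carrier _
  Scaled u r = Solvable A (λ k → eval module′ u (t k) *ᵣ r)

  scaled-isIdeal : ∀ u → IsIdeal (Scaled u)
  scaled-isIdeal u = record
    { resp     = λ r≈s → solvable-cong A λ k → *ᵣ-congˡ r≈s
    ; 0∈       = solvable-cong A (λ k → ≈ᴹ-sym (*ᵣ-zeroʳ _)) (solvable-0 A)
    ; +-closed = λ r∈ s∈ → solvable-cong A (λ k → ≈ᴹ-sym (*ᵣ-distribˡ _ _ _)) (solvable-+ A r∈ s∈)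
    ; *-closed = λ s {r} r∈ → solvable-cong A
        (λ k → ≈ᴹ-trans (*ᵣ-assoc _ r s) (*ᵣ-congˡ (*-comm r s))) (solvable-* A s r∈)
    }

  -- At each 𝓜 a branch containing 𝓜 is chosen. Its local divisions descend to M up to scalars
  -- outside 𝓜, and soundness turns them into an element of the ideal `Scaled u` outside 𝓜.
  solvable-1 : ∀ u → LocallySat u → Scaled u 1#
  solvable-1 u sat = local-global (scaled-isIdeal u) λ 𝓜 →
    let k , 𝓜∈C = covering 𝓜 in
    proj₂ (sound k u) 𝓜 𝓜∈C (All.map (∣⊗-delocalize D 𝓜 module′)
      (Equivalence.to (map-localAtom-sat (C k) 𝓜 𝓜∈C u (proj₂ (lookup bs k))) (sat k 𝓜 𝓜∈C)))

  from : ∀ u → Scaled u 1# → M_V ⊨ φ [ u ]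
  from u solvable = Equivalence.from (matrix-sat φ u)
    (solvable-cong A (λ k → *ᵣ-identityʳ _) solvable)
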